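{- For every weighted digraph $\Gamma$ with Kirchhoff matrix $L$ and normalized matrix of maximum out forests $\bar J$, put $Z=L+\bar J^{T}$. Then the matrix $$L^{T}(ZZ^{T})^{ -1}=L^{T}(\bar J^{T}\bar J+LL^{T})^{ -1}$$ is the Moore-Penrose generalized inverse of $L$.
   Context: $\Gamma$ is a weighted digraph without loops with vertex set $\{1,\dots,n\}$, $n>1$; all arcs have strictly positive real weights; $\varepsilon_{ij}$ denotes the weight of the arc from $i$ to $j$, with $\varepsilon_{ij}=0$ if and only if there is no such arc. The Kirchhoff matrix $L=(\ell_{ij})$ is the $n\times n$ matrix with $\ell_{ij}=-\varepsilon_{ji}$ for $j\ne i$ and $\ell_{ii}=-\sum_{k\ne i}\ell_{ik}$. The superscript $T$ denotes transposition. A diverging forest is a digraph without (directed) circuits in which every vertex has indegree at most 1; its weak components are diverging trees, each having a unique vertex of indegree 0 (its root) from which all vertices of the tree are reachable. An out forest of $\Gamma$ is a spanning subgraph of $\Gamma$ that is a diverging forest; a maximum out forest is an out forest with the greatest possible number of arcs. The out forest dimension $v$ is the number of weak components of any maximum out forest, so maximum out forests have $n-v$ arcs. The weight of a subgraph is the product of the weights of its arcs (1 if it has no arcs); the weight $\varepsilon(\mathcal G)$ of a set of subgraphs is the sum of the weights of its elements (0 for the empty set). The normalized matrix of maximum out forests is $\bar J=(\bar J_{ij})$ with $\bar J_{ij}=\varepsilon(\mathcal F_{n-v}^{j\to i})/\varepsilon(\mathcal F_{n-v})$, where $\mathcal F_{n-v}$ is the set of maximum out forests and $\mathcal F_{n-v}^{j\to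 i}$ is the set of those in which $i$ belongs to a tree with root $j$. The Moore-Penrose generalized inverse of a matrix $A$ is the unique matrix $X$ with $AXA=A$, $XAX=X$, $(AX)^*=AX$, $(XA)^*=XA$. -}

module Defs where

open import Algebra.Apartness.Bundles using (HeytingField; HeytingCommutativeRing)
open import Algebra.Bundles using (CommutativeRing)
import Algebra.Definitions
import Algebra.Definitions.RawMonoid
import Algebra.Properties.CommutativeMonoid.Sum
import Algebra.Properties.Ring
open import Algebra.Apartness.Properties.HeytingCommutativeRing using (x-0≈x; 1#0)
open import Data.Bool.Base using (if_then_else_)
open import Data.Empty using (⊥-elim)
open import Data.Fin.Base using (Fin; zero; suc)
open import Data.Fin.Properties using (all?; any?) renaming (_≟_ to _≟ᶠ_)
open import Data.Fin.Subset using (Subset; inside; outside; _∈_; _⊆_; ∣_∣) renaming (⊥ to ∅)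
open import Data.Fin.Subset.Properties using (_∈?_; _⊆?_; ∉⊥; ∣⊥∣≡0)
open import Data.List.Base using (List; []; _∷_; map; foldr; filter; cartesianProductWith; allFin)
open import Data.List.Extrema.Nat using (argmax; argmax-all; f[xs]≤f[argmax])
open import Data.List.Membership.Propositional using () renaming (_∈_ to _∈ₗ_)
open import Data.List.Membership.Propositional.Properties
  using (∈-filter⁺; ∈-filter⁻; ∈-cartesianProductWith⁺; ∈-allFin)
import Data.List.Relation.Unary.All as All
open import Data.List.Relation.Unary.Any using (here; there)
open import Data.Nat.Base as ℕ using (ℕ)
import Data.Nat.Properties as ℕ
open import Data.Product.Base using (∃; _×_; _,_; proj₁; proj₂)
open import Data.Sum.Base using (_⊎_; inj₁; inj₂; [_,_]′)
open import Data.Vec.Base using (Vec; []; _∷_; lookup; replicate)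
import Data.Vec.Base as Vec
open import Data.Vec.Properties using (lookup-replicate)
open import Function.Base using (_∘_; id)
open import Level using (Level; _⊔_) renaming (suc to lsuc)
open import Relation.Binary.Construct.Closure.Equivalence using (EqClosure)
open import Relation.Binary.Construct.Closure.ReflexiveTransitive using (Star; ε; _◅_)
open import Relation.Binary.Construct.Closure.Symmetric using (SymClosure; fwd; bwd)
open import Relation.Binary.Construct.Closure.Transitive using (TransClosure; [_]; _∷_; _++_)
open import Relation.Binary.Core using (Rel)
open import Relation.Binary.Definitions using () renaming (Decidable to Decidable₂)
open import Relation.Binary.PropositionalEquality.Core as ≡ using (_≡_)
open import Relation.Binary.Structures using (IsStrictPartialOrder)
open import Relation.Nullary using (¬_; yes; no)
open import Relation.Nullary.Decidable using (map′; ¬?; _×-dec_; _⊎-dec_; ⌊_⌋)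
open import Relation.Unary using (Decidable)

------------------------------------------------------------------------
-- The real numbers, given axiomatically as a Cauchy complete
-- Archimedean ordered field.  Classically these axioms determine ℝ up
-- to isomorphism.  The order is not assumed to be decidable, so that
-- the constructive Cauchy reals also satisfy them.

record RealField c ℓ₁ ℓ₂ : Set (lsuc (c ⊔ ℓ₁ ⊔ ℓ₂)) where
  field
    heytingField : HeytingField c ℓ₁ ℓ₂

  open HeytingField heytingField public

  commutativeRing : CommutativeRing c ℓ₁
  commutativeRing = HeytingCommutativeRing.commutativeRing heytingCommutativeRing

  open CommutativeRing commutativeRing public
    using (ring; +-rawMonoid; +-commutativeMonoid; *-commutativeMonoid)

  open Algebra.Definitions.RawMonoid +-rawMonoid public
    using () renaming (_×_ to _·_)

  infix 4 _<_

  field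
    _<_                  : Rel Carrier ℓ₂
    isStrictPartialOrder : IsStrictPartialOrder _≈_ _<_
    #⇒<⊎>                : ∀ {x y} → x # y → x < y ⊎ y < x
    <⇒#                  : ∀ {x y} → x < y → x # y
    +-monoˡ-<            : ∀ {x y} z → x < y → x + z < y + z
    *-pos                : ∀ {x y} → 0# < x → 0# < y → 0# < x * y

  IsCauchy : (ℕ → Carrier) → Set (c ⊔ ℓ₂)
  IsCauchy s = ∀ e → 0# < e → ∃ λ N → ∀ m n → N ℕ.≤ m → N ℕ.≤ n → s m < s n + e

  _ConvergesTo_ : (ℕ → Carrier) → Carrier → Set (c ⊔ ℓ₂)
  s ConvergesTo l = ∀ e → 0# < e →
    ∃ λ N → ∀ n → N ℕ.≤ n → (s n < l + e) × (l < s n + e)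

  field
    archimedean : ∀ x → ∃ λ n → x < n · 1#
    complete    : ∀ s → IsCauchy s → ∃ (s ConvergesTo_)

  open IsStrictPartialOrder isStrictPartialOrder public
    using (<-resp-≈; <-respˡ-≈; <-respʳ-≈)
    renaming (irrefl to <-irrefl; trans to <-trans)

------------------------------------------------------------------------
-- Digraphs on the vertex set Fin n, without multiple arcs.  The i-th
-- entry is the set of in-neighbours of i.

Digraph : ℕ → Set
Digraph n = Vec (Subset n) n

module _ {n : ℕ} where

  Arc : Digraph n → Rel (Fin n) _
  Arc G i j = i ∈ lookup G j

  indegree : Digraph n → Fin n → ℕ
  indegree G i = ∣ lookup G i ∣

  numArcs : Digraph n → ℕ
  numArcs G = Vec.sum (Vec.map ∣_∣ G)

  -- H ⊑ G: H is a spanning subgraph of G, identified with its arc set.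
  _⊑_ : Digraph n → Digraph n → Set
  H ⊑ G = ∀ i → lookup H i ⊆ lookup G i

  HasCircuit : Digraph n → Set
  HasCircuit G = ∃ λ i → TransClosure (Arc G) i i

  IsDivergingForest : Digraph n → Set
  IsDivergingForest G = ¬ HasCircuit G × (∀ i → indegree G i ℕ.≤ 1)

  SameWeakComponent : Digraph n → Rel (Fin n) _
  SameWeakComponent G = EqClosure (Arc G)

  IsRoot : Digraph n → Fin n → Set
  IsRoot G j = indegree G j ≡ 0

  InTreeRootedAt : Digraph n → Fin n → Fin n → Set
  InTreeRootedAt G j i = IsRoot G j × SameWeakComponent G j i

  IsOutForest : Digraph n → Digraph n → Set
  IsOutForest Γ F = F ⊑ Γ × IsDivergingForest F

  IsMaximumOutForest : Digraph n → Digraph n → Set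
  IsMaximumOutForest Γ F =
    IsOutForest Γ F × (∀ H → IsOutForest Γ H → numArcs H ℕ.≤ numArcs F)

------------------------------------------------------------------------
-- Decidability of transitive closures over Fin n (Warshall's algorithm)

module _ {n : ℕ} {ℓ : Level} {R : Rel (Fin n) ℓ} (R? : Decidable₂ R) where
  private
    -- Walks whose interior vertices lie in the given list.
    Via : List (Fin n) → Rel (Fin n) ℓ
    Via []       i j = R i j
    Via (k ∷ ks) i j = Via ks i j ⊎ (Via ks i k × Via ks k j)

    via? : ∀ ks → Decidable₂ (Via ks)
    via? []       i j = R? i j
    via? (k ∷ ks) i j = via? ks i j ⊎-dec (via? ks i k ×-dec via? ks k j)

    sound : ∀ ks {i j} → Via ks i j → TransClosure R i j
    sound []       r              = [ r ]
    sound (k ∷ ks) (inj₁ p)       = sound ks p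
    sound (k ∷ ks) (inj₂ (p , q)) = sound ks p ++ sound ks q

    weaken : ∀ ks {i j} → R i j → Via ks i j
    weaken []       r = r
    weaken (k ∷ ks) r = inj₁ (weaken ks r)

    join : ∀ {ks m i j} → m ∈ₗ ks → Via ks i m → Via ks m j → Via ks i j
    join (here ≡.refl) p q = inj₂ ([ id , proj₁ ]′ p , [ id , proj₂ ]′ q)
    join (there m∈) (inj₁ p)       (inj₁ q)       = inj₁ (join m∈ p q)
    join (there m∈) (inj₁ p)       (inj₂ (q , r)) = inj₂ (join m∈ p q , r)
    join (there m∈) (inj₂ (p , q)) (inj₁ r)       = inj₂ (p , join m∈ q r)
    join (there m∈) (inj₂ (p , _)) (inj₂ (_ , r)) = inj₂ (p , r)

    complete : ∀ {i j} → TransClosure R i j → Via (allFin n) i j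
    complete [ r ]    = weaken (allFin n) r
    complete (r ∷ rs) = join (∈-allFin _) (weaken (allFin n) r) (complete rs)

  transClosure? : Decidable₂ (TransClosure R)
  transClosure? i j = map′ (sound (allFin n)) complete (via? (allFin n) i j)

  star? : Decidable₂ (Star R)
  star? i j = map′ to from ((i ≟ᶠ j) ⊎-dec transClosure? i j)
    where
    to⁺ : ∀ {i j} → TransClosure R i j → Star R i j
    to⁺ [ r ]    = r ◅ ε
    to⁺ (r ∷ rs) = r ◅ to⁺ rs

    to : ∀ {i j} → i ≡ j ⊎ TransClosure R i j → Star R i j
    to (inj₁ ≡.refl) = ε
    to (inj₂ rs)     = to⁺ rs

    from : ∀ {i j} → Star R i j → i ≡ j ⊎ TransClosure R i j
    from ε        = inj₁ ≡.refl
    from (r ◅ rs) with from rs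
    ... | inj₁ ≡.refl = inj₂ [ r ]
    ... | inj₂ rs⁺    = inj₂ (r ∷ rs⁺)

------------------------------------------------------------------------
-- Enumeration of the maximum out forests of a digraph

vecs : ∀ {a} {A : Set a} → List A → ∀ n → List (Vec A n)
vecs xs ℕ.zero    = [] ∷ []
vecs xs (ℕ.suc n) = cartesianProductWith _∷_ xs (vecs xs n)

∈-vecs : ∀ {a} {A : Set a} {xs : List A} → (∀ x → x ∈ₗ xs) →
         ∀ {n} (v : Vec A n) → v ∈ₗ vecs xs n
∈-vecs ∈xs []      = here ≡.refl
∈-vecs ∈xs (x ∷ v) = ∈-cartesianProductWith⁺ _∷_ (∈xs x) (∈-vecs ∈xs v)

allDigraphs : ∀ n → List (Digraph n)
allDigraphs n = vecs (vecs (inside ∷ outside ∷ []) n) n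

∈-allDigraphs : ∀ {n} (G : Digraph n) → G ∈ₗ allDigraphs n
∈-allDigraphs = ∈-vecs (∈-vecs λ where
  inside  → here ≡.refl
  outside → there (here ≡.refl))

module _ {n : ℕ} where

  arc? : (G : Digraph n) → Decidable₂ (Arc G)
  arc? G i j = i ∈? lookup G j

  hasCircuit? : Decidable (HasCircuit {n})
  hasCircuit? G = any? λ i → transClosure? (arc? G) i i

  isDivergingForest? : Decidable (IsDivergingForest {n})
  isDivergingForest? G = ¬? (hasCircuit? G) ×-dec all? λ i → indegree G i ℕ.≤? 1

  inTreeRootedAt? : (G : Digraph n) → Decidable₂ (InTreeRootedAt G)
  inTreeRootedAt? G j i = (indegree G j ℕ.≟ 0) ×-dec star? sym? j i
    where
    sym? : Decidable₂ (SymClosure (Arc G))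
    sym? i j = map′ [ fwd , bwd ]′ (λ { (fwd a) → inj₁ a ; (bwd a) → inj₂ a })
                    (arc? G i j ⊎-dec arc? G j i)

  isOutForest? : (Γ : Digraph n) → Decidable (IsOutForest Γ)
  isOutForest? Γ F = all? (λ i → lookup F i ⊆? lookup Γ i) ×-dec isDivergingForest? F

  outForests : Digraph n → List (Digraph n)
  outForests Γ = filter (isOutForest? Γ) (allDigraphs n)

  ∈-outForests : ∀ {Γ F} → IsOutForest Γ F → F ∈ₗ outForests Γ
  ∈-outForests {Γ} {F} = ∈-filter⁺ (isOutForest? Γ) (∈-allDigraphs F)

  isMaximumOutForest? : (Γ : Digraph n) → Decidable (IsMaximumOutForest Γ)
  isMaximumOutForest? Γ F = isOutForest? Γ F ×-dec
    map′ (λ ps H H-out → All.lookup ps (∈-outForests {Γ} {H} H-out))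
         (λ max → All.tabulate λ {H} H∈ →
           max H (proj₂ (∈-filter⁻ (isOutForest? Γ) {xs = allDigraphs n} H∈)))
         (All.all? (λ H → numArcs H ℕ.≤? numArcs F) (outForests Γ))

  maximumOutForests : Digraph n → List (Digraph n)
  maximumOutForests Γ = filter (isMaximumOutForest? Γ) (allDigraphs n)

  maximumOutForestsAt : Digraph n → Fin n → Fin n → List (Digraph n)
  maximumOutForestsAt Γ j i =
    filter (λ F → inTreeRootedAt? F j i) (maximumOutForests Γ)

  private
    empty : Digraph n
    empty = replicate n ∅

    noArc : ∀ {i j} → ¬ Arc empty i j
    noArc {i} {j} a = ∉⊥ (≡.subst (i ∈_) (lookup-replicate j ∅) a)

    emptyIsOutForest : ∀ Γ → IsOutForest Γ empty
    emptyIsOutForest Γ =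
      (λ i {x} x∈ → ⊥-elim (noArc x∈)) ,
      (λ { (_ , [ a ]) → noArc a ; (_ , a ∷ _) → noArc a }) ,
      λ i → ℕ.≤-trans
        (ℕ.≤-reflexive (≡.trans (≡.cong ∣_∣ (lookup-replicate i ∅)) (∣⊥∣≡0 n)))
        ℕ.z≤n

  maximumOutForest-exists : ∀ Γ → ∃ λ F → F ∈ₗ maximumOutForests Γ
  maximumOutForest-exists Γ =
    best , ∈-filter⁺ (isMaximumOutForest? Γ) (∈-allDigraphs best)
      ( proj₂ (∈-filter⁻ (isOutForest? Γ) {xs = allDigraphs n} best∈)
      , λ H H-out → All.lookup (f[xs]≤f[argmax] empty (outForests Γ))
                               (∈-outForests {Γ} {H} H-out))
    where
    best : Digraph n
    best = argmax numArcs empty (outForests Γ)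

    best∈ : best ∈ₗ outForests Γ
    best∈ = argmax-all numArcs {P = _∈ₗ outForests Γ}
      (∈-outForests {Γ} {empty} (emptyIsOutForest Γ)) (All.tabulate id)

------------------------------------------------------------------------
-- Matrices and weights with real entries

module OverReals {c ℓ₁ ℓ₂} (ℝ : RealField c ℓ₁ ℓ₂) where
  open RealField ℝ hiding (zero)
  open Algebra.Properties.CommutativeMonoid.Sum +-commutativeMonoid using (sum)
  open Algebra.Properties.CommutativeMonoid.Sum *-commutativeMonoid
    using () renaming (sum to product)

  ----------------------------------------------------------------------
  -- Square matrices

  Matrix : ℕ → Set c
  Matrix n = Fin n → Fin n → Carrier

  module _ {n : ℕ} where

    infix  4 _≈ᴹ_
    infixl 6 _⊕_
    infixl 7 _⊗_
    infix  9 _ᵀ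

    _≈ᴹ_ : Rel (Matrix n) ℓ₁
    A ≈ᴹ B = ∀ i j → A i j ≈ B i j

    _⊕_ : Matrix n → Matrix n → Matrix n
    (A ⊕ B) i j = A i j + B i j

    _⊗_ : Matrix n → Matrix n → Matrix n
    (A ⊗ B) i j = sum λ k → A i k * B k j

    _ᵀ : Matrix n → Matrix n
    (A ᵀ) i j = A j i

    I : Matrix n
    I i j = if ⌊ i ≟ᶠ j ⌋ then 1# else 0#

    -- An inverse matrix together with the proof that it is one.
    Invertible : Matrix n → Set (c ⊔ ℓ₁)
    Invertible = Algebra.Definitions.Invertible _≈ᴹ_ I _⊗_

    -- The matrices are real, so the conjugate transpose is _ᵀ.
    record Penrose (A X : Matrix n) : Set (c ⊔ ℓ₁) where
      field
        AXA≈A  : A ⊗ X ⊗ A ≈ᴹ A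
        XAX≈X  : X ⊗ A ⊗ X ≈ᴹ X
        AX-sym : (A ⊗ X) ᵀ ≈ᴹ A ⊗ X
        XA-sym : (X ⊗ A) ᵀ ≈ᴹ X ⊗ A

    IsMoorePenroseInverse : Matrix n → Matrix n → Set (c ⊔ ℓ₁)
    IsMoorePenroseInverse A X = Penrose A X × (∀ Y → Penrose A Y → Y ≈ᴹ X)

  ----------------------------------------------------------------------
  -- Weighted digraphs

  record WeightedDigraph (n : ℕ) : Set (c ⊔ ℓ₁ ⊔ ℓ₂) where
    field
      arcs      : Digraph n
      loopless  : ∀ i → ¬ Arc arcs i i
      weight    : Fin n → Fin n → Carrier
      arc⇒0<    : ∀ {i j} → Arc arcs i j → 0# < weight i j
      ¬arc⇒≈0   : ∀ {i j} → ¬ Arc arcs i j → weight i j ≈ 0#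

  module _ {n : ℕ} (Γ : WeightedDigraph n) where
    open WeightedDigraph Γ renaming (weight to w)

    kirchhoff : Matrix n
    kirchhoff i j = if ⌊ i ≟ᶠ j ⌋
      then - sum (λ k → if ⌊ k ≟ᶠ i ⌋ then 0# else offDiagonal i k)
      else offDiagonal i j
      where
      offDiagonal : Matrix n
      offDiagonal i j = - w j i

    subgraphWeight : Digraph n → Carrier
    subgraphWeight G =
      product λ i → product λ j → if ⌊ arc? G i j ⌋ then w i j else 1#

    weightOf : List (Digraph n) → Carrier
    weightOf Gs = foldr _+_ 0# (map subgraphWeight Gs)

  ----------------------------------------------------------------------
  -- The total weight of the maximum out forests is positive, hence
  -- invertible.

  0<1 : 0# < 1#
  0<1 with #⇒<⊎> (1#0 heytingCommutativeRing)
  ... | inj₂ 0<1 = 0<1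
  ... | inj₁ 1<0 = <-respʳ-≈ -1*-1≈1 (*-pos 0<-1 0<-1)
    where
    open Algebra.Properties.Ring ring using (-1*x≈-x; -‿involutive)

    0<-1 : 0# < - 1#
    0<-1 = <-respˡ-≈ (-‿inverseʳ 1#) (<-respʳ-≈ (+-identityˡ (- 1#)) (+-monoˡ-< (- 1#) 1<0))

    -1*-1≈1 : - 1# * - 1# ≈ 1#
    -1*-1≈1 = trans (-1*x≈-x (- 1#)) (-‿involutive 1#)

  +-pos : ∀ {x y} → 0# < x → 0# < y → 0# < x + y
  +-pos {x} {y} 0<x 0<y = <-trans 0<y (<-respˡ-≈ (+-identityˡ y) (+-monoˡ-< y 0<x))

  product-pos : ∀ {n} {f : Fin n → Carrier} → (∀ i → 0# < f i) → 0# < product f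
  product-pos {ℕ.zero}  0<f = 0<1
  product-pos {ℕ.suc n} 0<f = *-pos (0<f zero) (product-pos (0<f ∘ suc))

  pos⇒invertible : ∀ {x} → 0# < x → Algebra.Definitions.Invertible _≈_ 1# _*_ x
  pos⇒invertible {x} 0<x with #⇒invertible (#-sym (<⇒# 0<x))
  ... | y , yx≈1 , xy≈1 =
    y , trans (*-congˡ (sym x-0≈)) yx≈1 , trans (*-congʳ (sym x-0≈)) xy≈1
    where x-0≈ = x-0≈x heytingCommutativeRing x

  module _ {n : ℕ} (Γ : WeightedDigraph n) where
    open WeightedDigraph Γ renaming (weight to w)

    subgraphWeight-pos : ∀ {G} → G ⊑ arcs → 0# < subgraphWeight Γ G
    subgraphWeight-pos {G} G⊑Γ = product-pos λ i → product-pos λ j → factor i j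
      where
      factor : ∀ i j → 0# < (if ⌊ arc? G i j ⌋ then w i j else 1#)
      factor i j with arc? G i j
      ... | yes a = arc⇒0< (G⊑Γ j a)
      ... | no  _ = 0<1

    weightOf-pos : ∀ {G} Gs → G ∈ₗ Gs → (∀ {H} → H ∈ₗ Gs → H ⊑ arcs) → 0# < weightOf Γ Gs
    weightOf-pos (H ∷ [])      _ ⊑Γ =
      <-respʳ-≈ (sym (+-identityʳ _)) (subgraphWeight-pos {H} (⊑Γ (here ≡.refl)))
    weightOf-pos (H ∷ K ∷ Hs)  _ ⊑Γ =
      +-pos (subgraphWeight-pos {H} (⊑Γ (here ≡.refl)))
            (weightOf-pos (K ∷ Hs) (here ≡.refl) (⊑Γ ∘ there))

    maximumOutForests-pos : 0# < weightOf Γ (maximumOutForests arcs)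
    maximumOutForests-pos =
      weightOf-pos (maximumOutForests arcs) (proj₂ (maximumOutForest-exists arcs))
        λ H∈ → proj₁ (proj₁ (proj₂
          (∈-filter⁻ (isMaximumOutForest? arcs) {xs = allDigraphs n} H∈)))

    totalWeight-invertible :
      Algebra.Definitions.Invertible _≈_ 1# _*_ (weightOf Γ (maximumOutForests arcs))
    totalWeight-invertible = pos⇒invertible maximumOutForests-pos

    J̄ : Matrix n
    J̄ i j = weightOf Γ (maximumOutForestsAt arcs j i) * proj₁ totalWeight-invertible

-- Let Q k be the matrix of forests with k arcs, whose (i, j) entry is the
-- total weight of those in which i lies in the tree with root j, and let
-- σ k be the total weight of all of them.  Then
--   Q (k + 1) + L Q k = σ (k + 1) I.
-- Indeed, in row i, group the forests by their arcs not ending in i.  Such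
-- a group consists of a forest G in which i is a root and of the forests
-- G + (m → i) with m outside the tree of i; the contributions of the latter
-- to L Q k cancel by antisymmetry, and that of G is what remains.
--
-- Hence every Q k is a polynomial in L.  For k = n − v the next Q and σ
-- vanish, so L J̄ = J̄ L = 0 and I − J̄ = L M for some M.  Therefore
-- A = Z Zᵀ = J̄ᵀ J̄ + L Lᵀ, and A is positive definite: if Lᵀ x and J̄ x both
-- vanish, so does x · x = Lᵀ x · M x + x · J̄ x.  Finally A L = L Lᵀ L, and A
-- commutes with L Lᵀ, from which the Penrose equations follow.
--
-- Neither the order nor equality of reals is decidable.  So positive
-- definiteness is stated with apartness, and A is inverted by elimination,
-- where the pivots are positive since Schur complements inherit it.

module Submission where

open import Defs
open import Algebra.Apartness.Properties.HeytingCommutativeRing using (x-0≈x; 1#0; invertibleˡ⇒#; #-congʳ)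
open import Algebra.Bundles using (CommutativeMonoid; CommutativeRing)
import Algebra.Properties.CommutativeMonoid.Sum
import Algebra.Properties.CommutativeSemigroup
import Algebra.Properties.Ring
import Algebra.Properties.Semiring.Sum
open import Data.Bool.Base using (if_then_else_)
open import Data.Empty using (⊥-elim)
open import Data.Fin.Base using (Fin; zero; suc; punchIn)
open import Data.Fin.Properties using (any?; suc-injective) renaming (_≟_ to _≟ᶠ_)
open import Data.Fin.Subset using (Subset; inside; outside; _∈_; ∣_∣; ⁅_⁆) renaming (⊥ to ∅)
open import Data.Fin.Subset.Properties
  using (_∈?_; ∉⊥; ∣⊥∣≡0; ∣⁅x⁆∣≡1; x∈⁅x⁆; x∈⁅y⁆⇒x≡y; x≢y⇒x∉⁅y⁆; p⊆q⇒∣p∣≤∣q∣)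
open import Data.List.Base using (List; []; _∷_; _++_; map; foldr; filter; cartesianProductWith)
open import Data.List.Membership.Propositional.Properties using (∈-filter⁻)
open import Data.List.Properties using (map-∘)
open import Data.Nat.Base as ℕ using (ℕ; s≤s)
import Data.Nat.Properties as ℕ
open import Data.Product.Base using (Σ; ∃; _×_; _,_; proj₁; proj₂)
open import Data.Sum.Base as Sum using (_⊎_; inj₁; inj₂; [_,_]′)
open import Data.Vec.Base as Vec using (Vec; []; _∷_; here; there; lookup; insertAt)
open import Data.Vec.Properties using (insertAt-lookup; insertAt-punchIn; lookup-map)
open import Function.Base using (_∘_)
open import Relation.Binary.Bundles using (Setoid)
open import Relation.Binary.Construct.Closure.ReflexiveTransitive as Star using (Star; ε; _◅_; _◅◅_)
open import Relation.Binary.Construct.Closure.Symmetric using (SymClosure; fwd; bwd)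
open import Relation.Binary.Construct.Closure.Transitive using (TransClosure; [_]; _∷_)
open import Relation.Binary.Core using (Rel)
open import Relation.Binary.PropositionalEquality.Core as ≡ using (_≡_; _≢_)
import Relation.Binary.Reasoning.Setoid
open import Relation.Nullary using (Dec; ¬_; yes; no)
open import Relation.Nullary.Decidable using (⌊_⌋; ¬?; _×-dec_; decidable-stable)
open import Relation.Unary using (Pred; Decidable)

-- Small subsets and closures of relations

∈⇒1≤∣∣ : ∀ {n} {x : Fin n} {s : Subset n} → x ∈ s → 1 ℕ.≤ ∣ s ∣
∈⇒1≤∣∣ {x = x} x∈s = ≡.subst (ℕ._≤ _) (∣⁅x⁆∣≡1 x)
  (p⊆q⇒∣p∣≤∣q∣ λ y∈ → ≡.subst (_∈ _) (≡.sym (x∈⁅y⁆⇒x≡y x y∈)) x∈s)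

∣∣≤1⇒unique : ∀ {n} {x y : Fin n} {s : Subset n} → ∣ s ∣ ℕ.≤ 1 → x ∈ s → y ∈ s → x ≡ y
∣∣≤1⇒unique                    ≤1       here       here       = ≡.refl
∣∣≤1⇒unique                    (s≤s ≤0) here       (there y∈) = ⊥-elim (ℕ.<⇒≱ (∈⇒1≤∣∣ y∈) ≤0)
∣∣≤1⇒unique                    (s≤s ≤0) (there x∈) here       = ⊥-elim (ℕ.<⇒≱ (∈⇒1≤∣∣ x∈) ≤0)
∣∣≤1⇒unique {s = inside  ∷ _} (s≤s ≤0) (there x∈) (there y∈) = ⊥-elim (ℕ.<⇒≱ (∈⇒1≤∣∣ x∈) ≤0)
∣∣≤1⇒unique {s = outside ∷ _} ≤1       (there x∈) (there y∈) = ≡.cong suc (∣∣≤1⇒unique ≤1 x∈ y∈)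

module _ {a ℓ} {A : Set a} {R : Rel A ℓ} where

  unsnoc : ∀ {x y} → Star R x y → x ≡ y ⊎ ∃ λ z → Star R x z × R z y
  unsnoc ε = inj₁ ≡.refl
  unsnoc (r ◅ rs) with unsnoc rs
  ... | inj₁ ≡.refl         = inj₂ (_ , ε , r)
  ... | inj₂ (_ , rs′ , r′) = inj₂ (_ , r ◅ rs′ , r′)

  ⁺-uncons : ∀ {x y} → TransClosure R x y → ∃ λ z → R x z × Star R z y
  ⁺-uncons [ r ]    = _ , r , ε
  ⁺-uncons (r ∷ rs) with ⁺-uncons rs
  ... | _ , r′ , rs′ = _ , r , r′ ◅ rs′

  ⁺-cons : ∀ {x y z} → R x y → Star R y z → TransClosure R x z
  ⁺-cons r ε        = [ r ]
  ⁺-cons r (s ◅ rs) = r ∷ ⁺-cons s rs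

-- Paths and roots in diverging forests

Path : ∀ {n} → Digraph n → Rel (Fin n) _
Path G = Star (Arc G)

module _ {n : ℕ} (G : Digraph n) where

  root⇒noArc : ∀ {i j} → IsRoot G j → ¬ Arc G i j
  root⇒noArc root a = ℕ.<⇒≢ (∈⇒1≤∣∣ a) (≡.sym root)

  pathToRoot : ∀ {i j} → IsRoot G j → Path G i j → i ≡ j
  pathToRoot root p with unsnoc p
  ... | inj₁ i≡j         = i≡j
  ... | inj₂ (_ , _ , a) = ⊥-elim (root⇒noArc root a)

  path⇒inTree : ∀ {i j} → IsRoot G j → Path G j i → InTreeRootedAt G j i
  path⇒inTree root p = root , Star.map fwd p

  module _ (indegree≤1 : ∀ i → indegree G i ℕ.≤ 1) where

    -- The undirected walk is followed while a directed path from the root to its current vertex is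
    -- maintained. A forward arc extends the path. A backward arc must be the last arc of the path,
    -- because indegrees are at most 1, and is dropped from it; the path is not empty then, since no
    -- arc ends in a root.
    inTree⇒path : ∀ {i j} → InTreeRootedAt G j i → Path G j i
    inTree⇒path {j = j} (root , walk) = extend ε walk
      where
      extend : ∀ {k l} → Path G j k → SameWeakComponent G k l → Path G j l
      extend p ε             = p
      extend p (fwd a ◅ w) = extend (p ◅◅ a ◅ ε) w
      extend p (bwd a ◅ w) with unsnoc p
      ... | inj₁ ≡.refl         = ⊥-elim (root⇒noArc root a)
      ... | inj₂ (_ , p′ , a′) with ∣∣≤1⇒unique (indegree≤1 _) a′ a
      ... | ≡.refl = extend p′ w

    -- Going on from `k` back to `i` shows that `i` lies in the tree of `j`. The resulting path from
    -- `j` ends in the root `i`, so it is empty.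
    root-unique : ∀ {i j k} → IsRoot G i → Path G i k → InTreeRootedAt G j k → j ≡ i
    root-unique rootᵢ p (rootⱼ , w) =
      pathToRoot rootᵢ (inTree⇒path (rootⱼ , w ◅◅ Star.reverse flip′ (Star.map fwd p)))
      where
      flip′ : ∀ {k l} → SymClosure (Arc G) k l → SymClosure (Arc G) l k
      flip′ (fwd a) = bwd a
      flip′ (bwd a) = fwd a

-- Attaching an arc to a root

-- H arises from G by adding the arc m → i, where i is a root of G.
module Attach {n} {G H : Digraph n} {i m : Fin n}
  (rowᴳ : lookup G i ≡ ∅) (rowᴴ : lookup H i ≡ ⁅ m ⁆)
  (rows : ∀ {x} → x ≢ i → lookup H x ≡ lookup G x) where

  rootᴳ : IsRoot G i
  rootᴳ = ≡.trans (≡.cong ∣_∣ rowᴳ) (∣⊥∣≡0 n)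

  indegreeᴴ : indegree H i ≡ 1
  indegreeᴴ = ≡.trans (≡.cong ∣_∣ rowᴴ) (∣⁅x⁆∣≡1 m)

  new : Arc H m i
  new = ≡.subst (m ∈_) (≡.sym rowᴴ) (x∈⁅x⁆ m)

  arc⁺ : ∀ {a b} → Arc G a b → Arc H a b
  arc⁺ {a} {b} a→b with b ≟ᶠ i
  ... | yes ≡.refl = ⊥-elim (root⇒noArc G rootᴳ a→b)
  ... | no  b≢i    = ≡.subst (a ∈_) (≡.sym (rows b≢i)) a→b

  arc⁻ : ∀ {a b} → Arc H a b → Arc G a b ⊎ (a ≡ m × b ≡ i)
  arc⁻ {a} {b} a→b with b ≟ᶠ i
  ... | yes ≡.refl = inj₂ (x∈⁅y⁆⇒x≡y m (≡.subst (a ∈_) rowᴴ a→b) , ≡.refl)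
  ... | no  b≢i    = inj₁ (≡.subst (a ∈_) (rows b≢i) a→b)

  path⁺ : ∀ {a b} → Path G a b → Path H a b
  path⁺ = Star.map arc⁺

  -- The path is cut at the last use of the new arc, so the part after the cut lies in `G`, while
  -- the part before it may use the arc again.
  path⁻ : ∀ {a b} → Path H a b → Path G a b ⊎ (Path H a m × Path G i b)
  path⁻ ε = inj₁ ε
  path⁻ (a ◅ p) with path⁻ p | arc⁻ a
  ... | inj₁ q       | inj₁ a′                = inj₁ (a′ ◅ q)
  ... | inj₁ q       | inj₂ (≡.refl , ≡.refl) = inj₂ (ε , q)
  ... | inj₂ (q , r) | _                      = inj₂ (a ◅ q , r)

  root⁺ : ∀ {j} → j ≢ i → IsRoot G j → IsRoot H j
  root⁺ j≢i = ≡.trans (≡.cong ∣_∣ (rows j≢i))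

  root⁻ : ∀ {j} → IsRoot H j → j ≢ i × IsRoot G j
  root⁻ {j} root = j≢i , ≡.trans (≡.cong ∣_∣ (≡.sym (rows j≢i))) root
    where
    j≢i : j ≢ i
    j≢i ≡.refl = ℕ.0≢1+n (≡.trans (≡.sym root) indegreeᴴ)

  -- The new arc would close a path from `i` to `m` to a circuit.
  forest⁻ : IsDivergingForest H → IsDivergingForest G × ¬ Path G i m
  forest⁻ (acyclic , indegree≤1) =
    ( (λ (x , c) → let (_ , a , p) = ⁺-uncons c in acyclic (x , ⁺-cons (arc⁺ a) (path⁺ p)))
    , indegreeᴳ) ,
    λ p → acyclic (m , ⁺-cons new (path⁺ p))
    where
    indegreeᴳ : ∀ x → indegree G x ℕ.≤ 1
    indegreeᴳ x with x ≟ᶠ i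
    ... | yes ≡.refl = ≡.subst (ℕ._≤ 1) (≡.sym rootᴳ) ℕ.z≤n
    ... | no  x≢i    = ≡.subst (λ s → ∣ s ∣ ℕ.≤ 1) (rows x≢i) (indegree≤1 x)

  module _ (forestᴳ : IsDivergingForest G) (¬i⇝m : ¬ Path G i m) where
    private
      indegreeᴳ≤1 = proj₂ forestᴳ

    pathTo-m⁻ : ∀ {a} → Path H a m → Path G a m
    pathTo-m⁻ p with path⁻ p
    ... | inj₁ q       = q
    ... | inj₂ (_ , q) = ⊥-elim (¬i⇝m q)

    -- A circuit that avoids the new arc lies in `G`, and one that uses it yields a path from `i` to
    -- `m` in `G`.
    forest⁺ : IsDivergingForest H
    forest⁺ = (λ (x , c) → noCircuit (⁺-uncons c)) , indegree≤1
      where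
      noCircuit : ∀ {x} → ¬ ∃ λ y → Arc H x y × Path H y x
      noCircuit (_ , a , p) with arc⁻ a | path⁻ p
      ... | inj₁ a′                | inj₁ q       = proj₁ forestᴳ (_ , ⁺-cons a′ q)
      ... | inj₁ a′                | inj₂ (q , r) = ¬i⇝m (r ◅◅ a′ ◅ pathTo-m⁻ q)
      ... | inj₂ (≡.refl , ≡.refl) | inj₁ q       = ¬i⇝m q
      ... | inj₂ (≡.refl , ≡.refl) | inj₂ (_ , r) = ¬i⇝m r

      indegree≤1 : ∀ x → indegree H x ℕ.≤ 1
      indegree≤1 x with x ≟ᶠ i
      ... | yes ≡.refl = ℕ.≤-reflexive indegreeᴴ
      ... | no  x≢i    = ≡.subst (λ s → ∣ s ∣ ℕ.≤ 1) (≡.sym (rows x≢i)) (indegreeᴳ≤1 x)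

    private
      inTreeᴴ⇒path : ∀ {j x} → InTreeRootedAt H j x → Path H j x
      inTreeᴴ⇒path = inTree⇒path H (proj₂ forest⁺)

      inTreeᴳ⇒path : ∀ {j x} → InTreeRootedAt G j x → Path G j x
      inTreeᴳ⇒path = inTree⇒path G indegreeᴳ≤1

    inTree-outside⁻ : ∀ {j x} → ¬ Path G i x → InTreeRootedAt H j x → InTreeRootedAt G j x
    inTree-outside⁻ ¬i⇝x t@(root , _) with path⁻ (inTreeᴴ⇒path t)
    ... | inj₁ p       = path⇒inTree G (proj₂ (root⁻ root)) p
    ... | inj₂ (_ , p) = ⊥-elim (¬i⇝x p)

    inTree-outside⁺ : ∀ {j x} → ¬ Path G i x → InTreeRootedAt G j x → InTreeRootedAt H j x
    inTree-outside⁺ {j} ¬i⇝x t@(root , _) = path⇒inTree H (root⁺ j≢i root) (path⁺ p)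
      where
      p = inTreeᴳ⇒path t
      j≢i : j ≢ i
      j≢i ≡.refl = ¬i⇝x p

    -- The path from `j` to `x` has to use the new arc, and so passes through `m`: otherwise `x`
    -- would lie in `G` in the trees of both `i` and `j`, which are distinct roots.
    inTree-inside⁻ : ∀ {j x} → Path G i x → InTreeRootedAt H j x → InTreeRootedAt G j m
    inTree-inside⁻ i⇝x t@(root , _) with root⁻ root | path⁻ (inTreeᴴ⇒path t)
    ... | _   , root′ | inj₂ (p , _) = path⇒inTree G root′ (pathTo-m⁻ p)
    ... | j≢i , root′ | inj₁ p       =
      ⊥-elim (j≢i (root-unique G indegreeᴳ≤1 rootᴳ i⇝x (path⇒inTree G root′ p)))

    inTree-inside⁺ : ∀ {j x} → Path G i x → InTreeRootedAt G j m → InTreeRootedAt H j x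
    inTree-inside⁺ {j} i⇝x t@(root , _) =
      path⇒inTree H (root⁺ j≢i root) (path⁺ p ◅◅ new ◅ path⁺ i⇝x)
      where
      p = inTreeᴳ⇒path t
      j≢i : j ≢ i
      j≢i ≡.refl = ¬i⇝m p

-- Finite sums over indices, lists, vectors and subsets

subsets : ∀ n → List (Subset n)
subsets = vecs (inside ∷ outside ∷ [])

-- The number of summands is a module parameter because Agda cannot infer
-- it, nor then the summands, from an equation between sums.
module FiniteSum {c ℓ} (M : CommutativeMonoid c ℓ) (n : ℕ) where
  open CommutativeMonoid M renaming (ε to 0#)
  open Algebra.Properties.CommutativeMonoid.Sum M

  ∑-cong : ∀ {f g : Fin n → Carrier} → (∀ i → f i ≈ g i) → sum f ≈ sum g
  ∑-cong = sum-cong-≋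

  ∑-zero : ∀ {f : Fin n → Carrier} → (∀ i → f i ≈ 0#) → sum f ≈ 0#
  ∑-zero f≈0 = trans (∑-cong f≈0) (sum-replicate-zero n)

  ∑-∙ : ∀ (f g : Fin n → Carrier) → sum (λ i → f i ∙ g i) ≈ sum f ∙ sum g
  ∑-∙ = ∑-distrib-+

∑-single : ∀ {c ℓ} (M : CommutativeMonoid c ℓ) → let open CommutativeMonoid M renaming (ε to 0#) in
           let open Algebra.Properties.CommutativeMonoid.Sum M using (sum) in
           ∀ n (i : Fin n) (f : Fin n → Carrier) → (∀ {j} → j ≢ i → f j ≈ 0#) → sum f ≈ f i
∑-single M (ℕ.suc n) zero f f≈0 =
  trans (∙-congˡ (∑-zero λ j → f≈0 λ ())) (identityʳ _)
  where
  open CommutativeMonoid M hiding (ε)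
  open FiniteSum M n
∑-single M (ℕ.suc n) (suc i) f f≈0 =
  trans (∙-cong (f≈0 λ ()) (∑-single M n i (f ∘ suc) λ j≢i → f≈0 (j≢i ∘ suc-injective))) (identityˡ _)
  where open CommutativeMonoid M hiding (ε)

module Summation {c ℓ} (R : CommutativeRing c ℓ) where
  open CommutativeRing R hiding (zero)
  open Algebra.Properties.Semiring.Sum semiring
    using (sum; sum-replicate-zero; *-distribˡ-sum; *-distribʳ-sum)
  open Algebra.Properties.CommutativeMonoid.Sum +-commutativeMonoid using (∑-distrib-+)
  open Algebra.Properties.CommutativeSemigroup +-commutativeSemigroup using (interchange)
  open Algebra.Properties.Ring ring
    using (x[y-z]≈xy-xz; -‿+-comm; -0#≈0#; x≈y⇒x∙y⁻¹≈ε)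
  open Relation.Binary.Reasoning.Setoid setoid

  𝟙 : ∀ {p} {P : Set p} → Dec P → Carrier
  𝟙 P? = if ⌊ P? ⌋ then 1# else 0#

  module _ {p} {P : Set p} where

    𝟙-true : (P? : Dec P) → P → 𝟙 P? ≡ 1#
    𝟙-true (yes _) _ = ≡.refl
    𝟙-true (no ¬p) p = ⊥-elim (¬p p)

    𝟙-false : (P? : Dec P) → ¬ P → 𝟙 P? ≡ 0#
    𝟙-false (yes p) ¬p = ⊥-elim (¬p p)
    𝟙-false (no _)  _  = ≡.refl

    𝟙-cong : ∀ {q} {Q : Set q} (P? : Dec P) (Q? : Dec Q) → (P → Q) → (Q → P) → 𝟙 P? ≡ 𝟙 Q?
    𝟙-cong P? (yes q) _   Q⇒P = 𝟙-true P? (Q⇒P q)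
    𝟙-cong P? (no ¬q) P⇒Q _   = 𝟙-false P? (¬q ∘ P⇒Q)

  sum-neg : ∀ {n} (f : Fin n → Carrier) → sum (λ i → - f i) ≈ - sum f
  sum-neg {ℕ.zero}  f = sym -0#≈0#
  sum-neg {ℕ.suc n} f = trans (+-congˡ (sum-neg (f ∘ suc))) (-‿+-comm _ _)

  module RingSum (n : ℕ) where
    open FiniteSum +-commutativeMonoid n public renaming (∑-∙ to ∑-+)

    ∑-- : ∀ (f g : Fin n → Carrier) → sum (λ i → f i - g i) ≈ sum f - sum g
    ∑-- f g = trans (∑-+ f (λ i → - g i)) (+-congˡ (sum-neg g))

    *-distribˡ-∑ : ∀ x (f : Fin n → Carrier) → x * sum f ≈ sum (λ i → x * f i)
    *-distribˡ-∑ = *-distribˡ-sum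

    *-distribʳ-∑ : ∀ x (f : Fin n → Carrier) → sum f * x ≈ sum (λ i → f i * x)
    *-distribʳ-∑ = *-distribʳ-sum

    -- Exchanging the two summation indices changes the sign.
    ∑-antisymmetric : ∀ (a r : Fin n → Carrier) →
                      sum (λ i → a i * sum λ j → a j * (r i - r j)) ≈ 0#
    ∑-antisymmetric a r = begin
      sum (λ i → a i * sum λ j → a j * (r i - r j))
        ≈⟨ ∑-cong (λ i → *-congˡ (begin
          sum (λ j → a j * (r i - r j))
            ≈⟨ ∑-cong (λ j → trans (x[y-z]≈xy-xz _ _ _) (+-congʳ (*-comm _ _))) ⟩
          sum (λ j → r i * a j - a j * r j)
            ≈⟨ ∑-- _ _ ⟩
          sum (λ j → r i * a j) - sum (λ j → a j * r j)
            ≈⟨ +-congʳ (*-distribˡ-∑ (r i) a) ⟨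
          r i * sum a - sum (λ j → a j * r j) ∎)) ⟩
      sum (λ i → a i * (r i * sum a - sum λ j → a j * r j))
        ≈⟨ ∑-cong (λ i → trans (x[y-z]≈xy-xz _ _ _) (+-congʳ (sym (*-assoc _ _ _)))) ⟩
      sum (λ i → a i * r i * sum a - a i * sum λ j → a j * r j)
        ≈⟨ ∑-- _ _ ⟩
      sum (λ i → a i * r i * sum a) - sum (λ i → a i * sum λ j → a j * r j)
        ≈⟨ +-cong (*-distribʳ-∑ (sum a) _) (-‿cong (*-distribʳ-∑ _ a)) ⟨
      sum (λ i → a i * r i) * sum a - sum a * sum (λ j → a j * r j)
        ≈⟨ x≈y⇒x∙y⁻¹≈ε (*-comm _ _) ⟩
      0# ∎

  ∑ₗ : ∀ {a} {A : Set a} → (A → Carrier) → List A → Carrier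
  ∑ₗ f xs = foldr _+_ 0# (map f xs)

  module _ {a} {A : Set a} where

    ∑ₗ-cong : ∀ {f g : A → Carrier} → (∀ x → f x ≈ g x) → ∀ xs → ∑ₗ f xs ≈ ∑ₗ g xs
    ∑ₗ-cong f≈g []       = refl
    ∑ₗ-cong f≈g (x ∷ xs) = +-cong (f≈g x) (∑ₗ-cong f≈g xs)

    ∑ₗ-zero : ∀ {f : A → Carrier} → (∀ x → f x ≈ 0#) → ∀ xs → ∑ₗ f xs ≈ 0#
    ∑ₗ-zero f≈0 []       = refl
    ∑ₗ-zero f≈0 (x ∷ xs) = trans (+-cong (f≈0 x) (∑ₗ-zero f≈0 xs)) (+-identityˡ 0#)

    ∑ₗ-++ : ∀ (f : A → Carrier) xs ys → ∑ₗ f (xs ++ ys) ≈ ∑ₗ f xs + ∑ₗ f ys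
    ∑ₗ-++ f []       ys = sym (+-identityˡ _)
    ∑ₗ-++ f (x ∷ xs) ys = trans (+-congˡ (∑ₗ-++ f xs ys)) (sym (+-assoc _ _ _))

    ∑ₗ-+ : ∀ (f g : A → Carrier) xs → ∑ₗ (λ x → f x + g x) xs ≈ ∑ₗ f xs + ∑ₗ g xs
    ∑ₗ-+ f g []       = sym (+-identityˡ 0#)
    ∑ₗ-+ f g (x ∷ xs) = trans (+-congˡ (∑ₗ-+ f g xs)) (interchange _ _ _ _)

    ∑ₗ-- : ∀ (f g : A → Carrier) xs → ∑ₗ (λ x → f x - g x) xs ≈ ∑ₗ f xs - ∑ₗ g xs
    ∑ₗ-- f g xs = trans (∑ₗ-+ f (λ x → - g x) xs) (+-congˡ (∑ₗ-neg xs))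
      where
      ∑ₗ-neg : ∀ xs → ∑ₗ (λ x → - g x) xs ≈ - ∑ₗ g xs
      ∑ₗ-neg []       = sym -0#≈0#
      ∑ₗ-neg (x ∷ xs) = trans (+-congˡ (∑ₗ-neg xs)) (-‿+-comm _ _)

    *-distribˡ-∑ₗ : ∀ y (f : A → Carrier) xs → y * ∑ₗ f xs ≈ ∑ₗ (λ x → y * f x) xs
    *-distribˡ-∑ₗ y f []       = zeroʳ y
    *-distribˡ-∑ₗ y f (x ∷ xs) = trans (distribˡ y _ _) (+-congˡ (*-distribˡ-∑ₗ y f xs))

    sum-∑ₗ-comm : ∀ {n} (f : Fin n → A → Carrier) xs →
                  sum (λ i → ∑ₗ (f i) xs) ≈ ∑ₗ (λ x → sum λ i → f i x) xs
    sum-∑ₗ-comm {n} f []       = sum-replicate-zero n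
    sum-∑ₗ-comm     f (x ∷ xs) =
      trans (∑-distrib-+ (λ i → f i x) (λ i → ∑ₗ (f i) xs)) (+-congˡ (sum-∑ₗ-comm f xs))

    ∑ₗ-filter : ∀ {p} {P : Pred A p} (P? : Decidable P) (f : A → Carrier) xs →
                ∑ₗ f (filter P? xs) ≈ ∑ₗ (λ x → 𝟙 (P? x) * f x) xs
    ∑ₗ-filter P? f []       = refl
    ∑ₗ-filter P? f (x ∷ xs) with P? x
    ... | yes _ = +-cong (sym (*-identityˡ _)) (∑ₗ-filter P? f xs)
    ... | no  _ = trans (∑ₗ-filter P? f xs) (sym (trans (+-congʳ (zeroˡ _)) (+-identityˡ _)))

  ∑ₗ-comm : ∀ {a b} {A : Set a} {B : Set b} (f : A → B → Carrier) xs ys →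
            ∑ₗ (λ x → ∑ₗ (f x) ys) xs ≈ ∑ₗ (λ y → ∑ₗ (λ x → f x y) xs) ys
  ∑ₗ-comm f []       ys = sym (∑ₗ-zero (λ _ → refl) ys)
  ∑ₗ-comm f (x ∷ xs) ys = trans (+-congˡ (∑ₗ-comm f xs ys)) (sym (∑ₗ-+ (f x) _ ys))

  ∑ₗ-product : ∀ {a b d} {A : Set a} {B : Set b} {D : Set d}
               (f : D → Carrier) (g : A → B → D) xs ys →
               ∑ₗ f (cartesianProductWith g xs ys) ≈ ∑ₗ (λ x → ∑ₗ (λ y → f (g x y)) ys) xs
  ∑ₗ-product f g []       ys = refl
  ∑ₗ-product f g (x ∷ xs) ys = begin
    ∑ₗ f (map (g x) ys ++ cartesianProductWith g xs ys)
      ≈⟨ ∑ₗ-++ f (map (g x) ys) _ ⟩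
    ∑ₗ f (map (g x) ys) + ∑ₗ f (cartesianProductWith g xs ys)
      ≈⟨ +-cong (reflexive (≡.cong (foldr _+_ 0#) (≡.sym (map-∘ ys)))) (∑ₗ-product f g xs ys) ⟩
    ∑ₗ (f ∘ g x) ys + ∑ₗ (λ x → ∑ₗ (λ y → f (g x y)) ys) xs ∎

  -- Applied to digraphs, this collects those that agree in all rows other than `i`.
  ∑ₗ-insertAt : ∀ {a} {A : Set a} (xs : List A) {n} (i : Fin (ℕ.suc n)) f →
                ∑ₗ f (vecs xs (ℕ.suc n)) ≈
                ∑ₗ (λ v → ∑ₗ (λ x → f (insertAt v i x)) xs) (vecs xs n)
  ∑ₗ-insertAt xs {n} zero f =
    trans (∑ₗ-product f _∷_ xs (vecs xs n)) (∑ₗ-comm (λ x v → f (x ∷ v)) xs (vecs xs n))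
  ∑ₗ-insertAt xs {ℕ.suc n} (suc i) f = begin
    ∑ₗ f (vecs xs (ℕ.suc (ℕ.suc n)))
      ≈⟨ ∑ₗ-product f _∷_ xs (vecs xs (ℕ.suc n)) ⟩
    ∑ₗ (λ y → ∑ₗ (λ v → f (y ∷ v)) (vecs xs (ℕ.suc n))) xs
      ≈⟨ ∑ₗ-cong (λ y → ∑ₗ-insertAt xs i (λ v → f (y ∷ v))) xs ⟩
    ∑ₗ (λ y → ∑ₗ (λ v → ∑ₗ (λ x → f (y ∷ insertAt v i x)) xs) (vecs xs n)) xs
      ≈⟨ ∑ₗ-product (λ v → ∑ₗ (λ x → f (insertAt v (suc i) x)) xs) _∷_ xs (vecs xs n) ⟨
    ∑ₗ (λ v → ∑ₗ (λ x → f (insertAt v (suc i) x)) xs) (vecs xs (ℕ.suc n)) ∎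

  ∑ₗ-subsets-∅ : ∀ n (f : Subset n → Carrier) → (∀ s → 1 ℕ.≤ ∣ s ∣ → f s ≈ 0#) →
                 ∑ₗ f (subsets n) ≈ f ∅
  ∑ₗ-subsets-∅ ℕ.zero    f f≈0 = +-identityʳ _
  ∑ₗ-subsets-∅ (ℕ.suc n) f f≈0 = begin
    ∑ₗ f (subsets (ℕ.suc n))
      ≈⟨ ∑ₗ-product f _∷_ (inside ∷ outside ∷ []) (subsets n) ⟩
    ∑ₗ (f ∘ (inside ∷_)) (subsets n) + (∑ₗ (f ∘ (outside ∷_)) (subsets n) + 0#)
      ≈⟨ +-cong (∑ₗ-zero (λ s → f≈0 (inside ∷ s) (s≤s ℕ.z≤n)) (subsets n))
                (trans (+-identityʳ _) (∑ₗ-subsets-∅ n (f ∘ (outside ∷_)) (f≈0 ∘ (outside ∷_)))) ⟩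
    0# + f ∅
      ≈⟨ +-identityˡ _ ⟩
    f ∅ ∎

  -- If the first element belongs to the set, only the empty rest contributes; if not, the rest is
  -- treated by induction. In the application the set is a row of a digraph, and larger rows violate
  -- the indegree bound of a forest.
  ∑ₗ-subsets : ∀ n (f : Subset n → Carrier) → (∀ s → 2 ℕ.≤ ∣ s ∣ → f s ≈ 0#) →
               ∑ₗ f (subsets n) ≈ f ∅ + sum (f ∘ ⁅_⁆)
  ∑ₗ-subsets ℕ.zero    f f≈0 = refl
  ∑ₗ-subsets (ℕ.suc n) f f≈0 = begin
    ∑ₗ f (subsets (ℕ.suc n))
      ≈⟨ ∑ₗ-product f _∷_ (inside ∷ outside ∷ []) (subsets n) ⟩
    ∑ₗ (f ∘ (inside ∷_)) (subsets n) + (∑ₗ (f ∘ (outside ∷_)) (subsets n) + 0#)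
      ≈⟨ +-cong (∑ₗ-subsets-∅ n (f ∘ (inside ∷_)) (λ s 1≤ → f≈0 (inside ∷ s) (s≤s 1≤)))
                (trans (+-identityʳ _) (∑ₗ-subsets n (f ∘ (outside ∷_)) (f≈0 ∘ (outside ∷_)))) ⟩
    f (inside ∷ ∅) + (f ∅ + sum (f ∘ ⁅_⁆ ∘ suc))
      ≈⟨ x∙yz≈y∙xz _ _ _ ⟩
    f ∅ + sum (f ∘ ⁅_⁆) ∎
    where open Algebra.Properties.CommutativeSemigroup +-commutativeSemigroup using (x∙yz≈y∙xz)

-- Vectors with an inserted entry

lookup-insertAt-other : ∀ {a} {A : Set a} {n} (v : Vec A n) (i : Fin (ℕ.suc n)) x y {k} →
                        k ≢ i → lookup (insertAt v i x) k ≡ lookup (insertAt v i y) k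
lookup-insertAt-other v        zero    x y {zero}  k≢i = ⊥-elim (k≢i ≡.refl)
lookup-insertAt-other v        zero    x y {suc k} k≢i = ≡.refl
lookup-insertAt-other (_ ∷ v) (suc i) x y {zero}  k≢i = ≡.refl
lookup-insertAt-other (_ ∷ v) (suc i) x y {suc k} k≢i = lookup-insertAt-other v i x y (k≢i ∘ ≡.cong suc)

sum-map-insertAt : ∀ {a} {A : Set a} (f : A → ℕ) {n} (v : Vec A n) i x →
                   Vec.sum (Vec.map f (insertAt v i x)) ≡ f x ℕ.+ Vec.sum (Vec.map f v)
sum-map-insertAt f v        zero    x = ≡.refl
sum-map-insertAt f (y ∷ v) (suc i) x = ≡.trans
  (≡.cong (f y ℕ.+_) (sum-map-insertAt f v i x))
  (x∙yz≈y∙xz (f y) (f x) _)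
  where open Algebra.Properties.CommutativeSemigroup ℕ.+-commutativeSemigroup using (x∙yz≈y∙xz)

-- The recurrence for the forest matrices

module Forests {c ℓ₁ ℓ₂} (ℝ : RealField c ℓ₁ ℓ₂) where
  open RealField ℝ hiding (zero)
  open OverReals ℝ
  open CommutativeRing commutativeRing using (*-commutativeSemigroup)
  open Summation commutativeRing
  open Algebra.Properties.CommutativeMonoid.Sum +-commutativeMonoid using (sum)
  open Algebra.Properties.CommutativeMonoid.Sum *-commutativeMonoid
    using () renaming (sum to product; sum-remove to product-remove; ∑-comm to ∏-comm)
  open Algebra.Properties.Ring ring
    using (x[y-z]≈xy-xz; -‿distribˡ-*; -‿distribʳ-*; ⁻¹-anti-homo‿-)
    renaming (x≈y⇒x∙y⁻¹≈ε to x≈y⇒x-y≈0)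
  open Relation.Binary.Reasoning.Setoid setoid

  -- The rows of the Kirchhoff matrix sum to zero, so it acts by weighted differences.
  kirchhoff-sum : ∀ {n} (Γ : WeightedDigraph n) (x : Fin n → Carrier) i →
                  let open WeightedDigraph Γ in
                  sum (λ m → kirchhoff Γ i m * x m) ≈ sum (λ m → weight m i * (x i - x m))
  kirchhoff-sum Γ x i = begin
    sum (λ m → L i m * x m)
      ≈⟨ ∑-cong (λ m → split m) ⟩
    sum (λ m → off m * x m + I i m * (- sum off * x i))
      ≈⟨ ∑-+ _ _ ⟩
    sum (λ m → off m * x m) + sum (λ m → I i m * (- sum off * x i))
      ≈⟨ +-congˡ (trans (∑-single +-commutativeMonoid _ i _ λ m≢i → trans
           (*-congʳ (reflexive (𝟙-false (i ≟ᶠ _) (m≢i ∘ ≡.sym)))) (zeroˡ _))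
           (trans (*-congʳ (reflexive (𝟙-true (i ≟ᶠ i) ≡.refl))) (*-identityˡ _))) ⟩
    sum (λ m → off m * x m) + - sum off * x i
      ≈⟨ +-congˡ (trans (sym (-‿distribˡ-* _ _)) (-‿cong (*-distribʳ-∑ (x i) off))) ⟩
    sum (λ m → off m * x m) - sum (λ m → off m * x i)
      ≈⟨ ∑-- _ _ ⟨
    sum (λ m → off m * x m - off m * x i)
      ≈⟨ ∑-cong (λ m → trans (sym (x[y-z]≈xy-xz _ _ _)) (flip m)) ⟩
    sum (λ m → w m i * (x i - x m)) ∎
    where
    open WeightedDigraph Γ renaming (weight to w)
    open RingSum _
    L = kirchhoff Γ

    off : Fin _ → Carrier
    off m = if ⌊ m ≟ᶠ i ⌋ then 0# else - w m i

    split : ∀ m → L i m * x m ≈ off m * x m + I i m * (- sum off * x i)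
    split m with i ≟ᶠ m | m ≟ᶠ i
    ... | yes ≡.refl | yes _   = sym (trans (+-cong (zeroˡ _) (*-identityˡ _)) (+-identityˡ _))
    ... | yes ≡.refl | no i≢i  = ⊥-elim (i≢i ≡.refl)
    ... | no i≢i     | yes ≡.refl = ⊥-elim (i≢i ≡.refl)
    ... | no _       | no _    = sym (trans (+-congˡ (zeroˡ _)) (+-identityʳ _))

    flip : ∀ m → off m * (x m - x i) ≈ w m i * (x i - x m)
    flip m with m ≟ᶠ i
    ... | yes ≡.refl = trans (zeroˡ _) (sym (trans (*-congˡ (-‿inverseʳ _)) (zeroʳ _)))
    ... | no _       = begin
      - w m i * (x m - x i)    ≈⟨ -‿distribˡ-* _ _ ⟨
      - (w m i * (x m - x i))  ≈⟨ -‿distribʳ-* _ _ ⟩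
      w m i * - (x m - x i)    ≈⟨ *-congˡ (⁻¹-anti-homo‿- _ _) ⟩
      w m i * (x i - x m)      ∎

  -- Opaque, because the decision procedures are expensive to unfold.
  opaque
    inTree : ∀ {n} → Digraph n → Matrix n
    inTree G i j = 𝟙 (inTreeRootedAt? G j i)

    inTree-def : ∀ {n} (G : Digraph n) i j → inTree G i j ≡ 𝟙 (inTreeRootedAt? G j i)
    inTree-def G i j = ≡.refl

  inTree-cong : ∀ {n} {G H : Digraph n} {i j k l} →
                (InTreeRootedAt G j i → InTreeRootedAt H l k) →
                (InTreeRootedAt H l k → InTreeRootedAt G j i) →
                inTree G i j ≡ inTree H k l
  inTree-cong {G = G} {H} {i} {j} {k} {l} to from = ≡.trans (inTree-def G i j) (≡.trans
    (𝟙-cong (inTreeRootedAt? G j i) (inTreeRootedAt? H l k) to from) (≡.sym (inTree-def H k l)))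

  module _ {n : ℕ} (Γ : WeightedDigraph n) where
    open WeightedDigraph Γ renaming (weight to w)

    isForestOfSize? : ∀ k (G : Digraph n) → Dec (IsDivergingForest G × numArcs G ≡ k)
    isForestOfSize? k G = isDivergingForest? G ×-dec numArcs G ℕ.≟ k

    opaque
      forestWeight : ℕ → Digraph n → Carrier
      forestWeight k G = 𝟙 (isForestOfSize? k G) * subgraphWeight Γ G

      forestWeight-def : ∀ k G → forestWeight k G ≡ 𝟙 (isForestOfSize? k G) * subgraphWeight Γ G
      forestWeight-def k G = ≡.refl

    forestWeight-¬forest : ∀ k {G} → ¬ IsDivergingForest G → forestWeight k G ≈ 0#
    forestWeight-¬forest k {G} ¬forest = trans (reflexive (forestWeight-def k G))
      (trans (*-congʳ (reflexive (𝟙-false (isForestOfSize? k G) (¬forest ∘ proj₁)))) (zeroˡ _))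

    -- All diverging forests on the vertex set count here, but the weight
    -- of those that are not contained in Γ is zero.
    σ : ℕ → Carrier
    σ k = ∑ₗ (forestWeight k) (allDigraphs n)

    Q : ℕ → Matrix n
    Q k i j = ∑ₗ (λ G → forestWeight k G * inTree G i j) (allDigraphs n)

    rowWeight : Fin n → Subset n → Carrier
    rowWeight i s = product λ j → if ⌊ j ∈? s ⌋ then w j i else 1#

    rowWeight-∅ : ∀ i → rowWeight i ∅ ≈ 1#
    rowWeight-∅ i = FiniteSum.∑-zero *-commutativeMonoid n one
      where
      one : ∀ j → (if ⌊ j ∈? ∅ ⌋ then w j i else 1#) ≈ 1#
      one j with j ∈? ∅
      ... | yes j∈∅ = ⊥-elim (∉⊥ j∈∅)
      ... | no  _   = refl

    rowWeight-⁅⁆ : ∀ i m → rowWeight i ⁅ m ⁆ ≈ w m i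
    rowWeight-⁅⁆ i m = trans (∑-single *-commutativeMonoid n m _ one) at-m
      where
      one : ∀ {j} → j ≢ m → (if ⌊ j ∈? ⁅ m ⁆ ⌋ then w j i else 1#) ≈ 1#
      one {j} j≢m with j ∈? ⁅ m ⁆
      ... | yes j∈ = ⊥-elim (x≢y⇒x∉⁅y⁆ j≢m j∈)
      ... | no  _  = refl

      at-m : (if ⌊ m ∈? ⁅ m ⁆ ⌋ then w m i else 1#) ≈ w m i
      at-m with m ∈? ⁅ m ⁆
      ... | yes _ = refl
      ... | no m∉ = ⊥-elim (m∉ (x∈⁅x⁆ m))

  -- Exchanging the two products sorts the factors by the heads of the arcs, after which the row of
  -- `i` splits off.
  subgraphWeight-insertAt : ∀ {n} (Γ : WeightedDigraph (ℕ.suc n)) u i s →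
    subgraphWeight Γ (insertAt u i s) ≈
    rowWeight Γ i s * product λ k → rowWeight Γ (punchIn i k) (lookup u k)
  subgraphWeight-insertAt Γ u i s = begin
    subgraphWeight Γ G
      ≈⟨ ∏-comm (λ a b → if ⌊ arc? G a b ⌋ then w a b else 1#) ⟩
    product (λ k → rowWeight Γ k (lookup G k))
      ≈⟨ product-remove {i = i} (λ k → rowWeight Γ k (lookup G k)) ⟩
    rowWeight Γ i (lookup G i) *
    product (λ k → rowWeight Γ (punchIn i k) (lookup G (punchIn i k)))
      ≈⟨ *-cong (reflexive (≡.cong (rowWeight Γ i) (insertAt-lookup u i s)))
           (FiniteSum.∑-cong *-commutativeMonoid _ λ k →
             reflexive (≡.cong (rowWeight Γ (punchIn i k)) (insertAt-punchIn u i s k))) ⟩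
    rowWeight Γ i s * product (λ k → rowWeight Γ (punchIn i k) (lookup u k)) ∎
    where
    open WeightedDigraph Γ renaming (weight to w)
    G = insertAt u i s

  -- The forests that differ from G only in the arcs into the vertex i are
  -- G itself and some of the H m.
  module _ {n : ℕ} (Γ : WeightedDigraph n) (i : Fin n) (G : Digraph n) (H : Fin n → Digraph n)
    (rowᴳ : lookup G i ≡ ∅) (rowᴴ : ∀ m → lookup (H m) i ≡ ⁅ m ⁆)
    (rows : ∀ m {x} → x ≢ i → lookup (H m) x ≡ lookup G x)
    (numArcsᴴ : ∀ m → numArcs (H m) ≡ ℕ.suc (numArcs G))
    (Wᴴ : ∀ m → subgraphWeight Γ (H m) ≈ WeightedDigraph.weight Γ m i * subgraphWeight Γ G)
    where
    open WeightedDigraph Γ renaming (weight to w)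
    open RingSum n
    private
      W = subgraphWeight Γ

      module A (m : Fin n) = Attach {G = G} {H = H m} {i = i} {m = m} rowᴳ (rowᴴ m) (rows m)

      rootᴳ : IsRoot G i
      rootᴳ = A.rootᴳ i

    module _ (forestᴳ : IsDivergingForest G) (j : Fin n) where
      private
        i⇝? : ∀ x → Dec (Path G i x)
        i⇝? = star? (arc? G) i

        -- The weight of `m → i`, set to zero where attaching this arc to `G` would close a circuit.
        a : Fin n → Carrier
        a m = if ⌊ i⇝? m ⌋ then 0# else w m i

        r : Fin n → Carrier
        r m = inTree G m j

        rᴴ : Fin n → Fin n → Carrier
        rᴴ m x = inTree (H m) x j

        -- The index counts the arcs of the `H m`, one more than those of `G`; hence the shift in
        -- `forestWeightᴳ`.
        β : ℕ → Carrier
        β k = 𝟙 (ℕ.suc (numArcs G) ℕ.≟ k) * W G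

        r-inside : ∀ {x} → Path G i x → r x ≈ I i j
        r-inside {x} i⇝x = reflexive (≡.trans (inTree-def G x j) (𝟙-cong (inTreeRootedAt? G j x) (i ≟ᶠ j)
          (λ t → ≡.sym (root-unique G (proj₂ forestᴳ) rootᴳ i⇝x t))
          (λ where ≡.refl → path⇒inTree G rootᴳ i⇝x)))

        forestWeightᴳ : ∀ k → forestWeight Γ k G ≈ β (ℕ.suc k)
        forestWeightᴳ k = trans (reflexive (forestWeight-def Γ k G)) (*-congʳ (reflexive (𝟙-cong
          (isForestOfSize? Γ k G) (ℕ.suc (numArcs G) ℕ.≟ ℕ.suc k)
          (λ (_ , eq) → ≡.cong ℕ.suc eq) (λ eq → forestᴳ , ℕ.suc-injective eq))))

        forestWeightᴴ : ∀ k m → forestWeight Γ k (H m) ≈ β k * a m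
        forestWeightᴴ k m with i⇝? m
        ... | yes i⇝m = trans (forestWeight-¬forest Γ k λ forest → proj₂ (A.forest⁻ m forest) i⇝m)
                              (sym (zeroʳ _))
        ... | no ¬i⇝m = begin
          forestWeight Γ k (H m)
            ≡⟨ forestWeight-def Γ k (H m) ⟩
          𝟙 (isForestOfSize? Γ k (H m)) * W (H m)
            ≈⟨ *-cong (reflexive (𝟙-cong (isForestOfSize? Γ k (H m)) (ℕ.suc (numArcs G) ℕ.≟ k)
                 (λ (_ , eq) → ≡.trans (≡.sym (numArcsᴴ m)) eq)
                 (λ eq → A.forest⁺ m forestᴳ ¬i⇝m , ≡.trans (numArcsᴴ m) eq)))
                 (trans (Wᴴ m) (*-comm _ _)) ⟩
          𝟙 (ℕ.suc (numArcs G) ℕ.≟ k) * (W G * w m i)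
            ≈⟨ *-assoc _ _ _ ⟨
          β k * w m i ∎

        -- Outside the tree of i nothing changes, and inside it the root
        -- becomes that of m.
        rᴴ-inside : ∀ {m x} → ¬ Path G i m → Path G i x → rᴴ m x ≈ r m
        rᴴ-inside {m} {x} ¬i⇝m i⇝x = reflexive (inTree-cong
          (A.inTree-inside⁻ m forestᴳ ¬i⇝m i⇝x) (A.inTree-inside⁺ m forestᴳ ¬i⇝m i⇝x))

        rᴴ-outside : ∀ {m x} → ¬ Path G i m → ¬ Path G i x → rᴴ m x ≈ r x
        rᴴ-outside {m} {x} ¬i⇝m ¬i⇝x = reflexive (inTree-cong
          (A.inTree-outside⁻ m forestᴳ ¬i⇝m ¬i⇝x) (A.inTree-outside⁺ m forestᴳ ¬i⇝m ¬i⇝x))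

        a-cong : ∀ m {y z} → (¬ Path G i m → y ≈ z) → a m * y ≈ a m * z
        a-cong m y≈z with i⇝? m
        ... | yes _    = trans (zeroˡ _) (sym (zeroˡ _))
        ... | no ¬i⇝m = *-congˡ (y≈z ¬i⇝m)

        -- A difference of tree indicators vanishes when both vertices lie in the tree of `i`, and
        -- then `w x i` may be replaced by `a x`.
        restrict : ∀ {x y z} → (Path G i x → y ≈ 0#) → (¬ Path G i x → y ≈ z) →
                   w x i * y ≈ a x * z
        restrict {x} y≈0 y≈z with i⇝? x
        ... | yes i⇝x = trans (*-congˡ (y≈0 i⇝x)) (trans (zeroʳ _) (sym (zeroˡ _)))
        ... | no ¬i⇝x = *-congˡ (y≈z ¬i⇝x)

      -- Both sides equal `β (ℕ.suc k) * sum (λ x → a x * (I i j - r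
      -- x))`. On the left this is the term of `G`, and the `H m` form an antisymmetric double sum.
      -- On the right it comes from the `H m`, and the term of `G` vanishes because `i` is its own
      -- root there.
      L⊗Q-localForest : ∀ k →
        forestWeight Γ k G * sum (λ x → w x i * (r i - r x)) +
        sum (λ m → forestWeight Γ k (H m) * sum λ x → w x i * (rᴴ m i - rᴴ m x)) ≈
        forestWeight Γ (ℕ.suc k) G * (I i j - r i) +
        sum (λ m → forestWeight Γ (ℕ.suc k) (H m) * (I i j - rᴴ m i))
      L⊗Q-localForest k = begin
        forestWeight Γ k G * sum (λ x → w x i * (r i - r x)) +
        sum (λ m → forestWeight Γ k (H m) * sum λ x → w x i * (rᴴ m i - rᴴ m x))
          ≈⟨ +-cong (*-cong (forestWeightᴳ k) (∑-cong λ x → restrict {x}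
               (λ i⇝x → x≈y⇒x-y≈0 (trans (r-inside ε) (sym (r-inside i⇝x))))
               (λ _ → +-congʳ (r-inside ε)))) (begin
            sum (λ m → forestWeight Γ k (H m) * sum λ x → w x i * (rᴴ m i - rᴴ m x))
              ≈⟨ ∑-cong (λ m → trans (*-congʳ (forestWeightᴴ k m)) (trans (*-assoc _ _ _)
                   (*-congˡ (a-cong m λ ¬i⇝m → ∑-cong λ x → restrict {x}
                     (λ i⇝x → x≈y⇒x-y≈0 (trans (rᴴ-inside ¬i⇝m ε) (sym (rᴴ-inside ¬i⇝m i⇝x))))
                     (λ ¬i⇝x → +-cong (rᴴ-inside ¬i⇝m ε) (-‿cong (rᴴ-outside ¬i⇝m ¬i⇝x))))))) ⟩
            sum (λ m → β k * (a m * sum λ x → a x * (r m - r x)))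
              ≈⟨ *-distribˡ-∑ (β k) _ ⟨
            β k * sum (λ m → a m * sum λ x → a x * (r m - r x))
              ≈⟨ trans (*-congˡ (∑-antisymmetric a r)) (zeroʳ _) ⟩
            0# ∎) ⟩
        β (ℕ.suc k) * sum (λ x → a x * (I i j - r x)) + 0#
          ≈⟨ +-comm _ _ ⟩
        0# + β (ℕ.suc k) * sum (λ x → a x * (I i j - r x))
          ≈⟨ +-cong
               (sym (trans (*-congˡ (x≈y⇒x-y≈0 (sym (r-inside ε)))) (zeroʳ _)))
               (trans (*-distribˡ-∑ _ _) (∑-cong λ m → begin
                 β (ℕ.suc k) * (a m * (I i j - r m))
                   ≈⟨ *-congˡ (a-cong m λ ¬i⇝m → +-congˡ (-‿cong (sym (rᴴ-inside ¬i⇝m ε)))) ⟩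
                 β (ℕ.suc k) * (a m * (I i j - rᴴ m i))
                   ≈⟨ *-assoc _ _ _ ⟨
                 β (ℕ.suc k) * a m * (I i j - rᴴ m i)
                   ≈⟨ *-congʳ (forestWeightᴴ (ℕ.suc k) m) ⟨
                 forestWeight Γ (ℕ.suc k) (H m) * (I i j - rᴴ m i) ∎)) ⟩
        forestWeight Γ (ℕ.suc k) G * (I i j - r i) +
        sum (λ m → forestWeight Γ (ℕ.suc k) (H m) * (I i j - rᴴ m i)) ∎

    -- If `G` is not a forest, then no `H m` is one, and both sides vanish.
    L⊗Q-local : ∀ k j →
      forestWeight Γ k G * sum (λ x → w x i * (inTree G i j - inTree G x j)) +
      sum (λ m → forestWeight Γ k (H m) *
        sum λ x → w x i * (inTree (H m) i j - inTree (H m) x j)) ≈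
      forestWeight Γ (ℕ.suc k) G * (I i j - inTree G i j) +
      sum (λ m → forestWeight Γ (ℕ.suc k) (H m) * (I i j - inTree (H m) i j))
    L⊗Q-local k j = byCases (isDivergingForest? G)
      where
      vanish : ¬ IsDivergingForest G → ∀ k {y : Carrier} {z : Fin n → Carrier} →
               forestWeight Γ k G * y + sum (λ m → forestWeight Γ k (H m) * z m) ≈ 0#
      vanish ¬forestᴳ k = trans (+-cong
        (trans (*-congʳ (forestWeight-¬forest Γ k ¬forestᴳ)) (zeroˡ _))
        (∑-zero λ m → trans (*-congʳ (forestWeight-¬forest Γ k
          (¬forestᴳ ∘ proj₁ ∘ A.forest⁻ m))) (zeroˡ _)))
        (+-identityˡ 0#)

      byCases : Dec (IsDivergingForest G) → _
      byCases (yes forestᴳ) = L⊗Q-localForest forestᴳ j k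
      byCases (no ¬forestᴳ) = trans (vanish ¬forestᴳ k) (sym (vanish ¬forestᴳ (ℕ.suc k)))

  module _ {n : ℕ} (Γ : WeightedDigraph n) (k : ℕ) (i j : Fin n) where
    open WeightedDigraph Γ renaming (weight to w)
    open RingSum n
    open Algebra.Properties.CommutativeSemigroup *-commutativeSemigroup using (x∙yz≈y∙xz)
    private
      Fs = allDigraphs n
      fw = forestWeight Γ

    L⊗Q-summand σI-Q-summand : Digraph n → Carrier
    L⊗Q-summand F = fw k F * sum λ m → w m i * (inTree F i j - inTree F m j)
    σI-Q-summand F = fw (ℕ.suc k) F * (I i j - inTree F i j)

    L⊗Q-expand : (kirchhoff Γ ⊗ Q Γ k) i j ≈ ∑ₗ L⊗Q-summand Fs
    L⊗Q-expand = begin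
      (kirchhoff Γ ⊗ Q Γ k) i j
        ≈⟨ kirchhoff-sum Γ (λ m → Q Γ k m j) i ⟩
      sum (λ m → w m i * (Q Γ k i j - Q Γ k m j))
        ≈⟨ ∑-cong (λ m → *-congˡ (∑ₗ-- (λ F → fw k F * inTree F i j) (λ F → fw k F * inTree F m j) Fs)) ⟨
      sum (λ m → w m i * ∑ₗ (λ F → fw k F * inTree F i j - fw k F * inTree F m j) Fs)
        ≈⟨ ∑-cong (λ m → *-distribˡ-∑ₗ (w m i) _ Fs) ⟩
      sum (λ m → ∑ₗ (λ F → w m i * (fw k F * inTree F i j - fw k F * inTree F m j)) Fs)
        ≈⟨ sum-∑ₗ-comm (λ m F → w m i * (fw k F * inTree F i j - fw k F * inTree F m j)) Fs ⟩
      ∑ₗ (λ F → sum λ m → w m i * (fw k F * inTree F i j - fw k F * inTree F m j)) Fs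
        ≈⟨ ∑ₗ-cong (λ F → begin
          sum (λ m → w m i * (fw k F * inTree F i j - fw k F * inTree F m j))
            ≈⟨ ∑-cong (λ m → trans (*-congˡ (sym (x[y-z]≈xy-xz _ _ _))) (x∙yz≈y∙xz _ _ _)) ⟩
          sum (λ m → fw k F * (w m i * (inTree F i j - inTree F m j)))
            ≈⟨ *-distribˡ-∑ (fw k F) _ ⟨
          L⊗Q-summand F ∎) Fs ⟩
      ∑ₗ L⊗Q-summand Fs ∎

    σI-Q-expand : σ Γ (ℕ.suc k) * I i j - Q Γ (ℕ.suc k) i j ≈ ∑ₗ σI-Q-summand Fs
    σI-Q-expand = begin
      σ Γ (ℕ.suc k) * I i j - Q Γ (ℕ.suc k) i j
        ≈⟨ +-congʳ (trans (*-comm _ _) (*-distribˡ-∑ₗ (I i j) _ Fs)) ⟩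
      ∑ₗ (λ F → I i j * fw (ℕ.suc k) F) Fs - Q Γ (ℕ.suc k) i j
        ≈⟨ ∑ₗ-- _ _ Fs ⟨
      ∑ₗ (λ F → I i j * fw (ℕ.suc k) F - fw (ℕ.suc k) F * inTree F i j) Fs
        ≈⟨ ∑ₗ-cong (λ F → trans (+-congʳ (*-comm _ _)) (sym (x[y-z]≈xy-xz _ _ _))) Fs ⟩
      ∑ₗ σI-Q-summand Fs ∎

  -- Both sides are sums over all digraphs, grouped by the rows other than `i`. In each group only
  -- an empty or a one-element row `i` can give a forest, and `L⊗Q-local` compares these
  -- contributions.
  L⊗Q : ∀ {n} (Γ : WeightedDigraph n) k i j →
        (kirchhoff Γ ⊗ Q Γ k) i j ≈ σ Γ (ℕ.suc k) * I i j - Q Γ (ℕ.suc k) i j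
  L⊗Q {ℕ.suc n} Γ k i j = begin
    (kirchhoff Γ ⊗ Q Γ k) i j
      ≈⟨ L⊗Q-expand Γ k i j ⟩
    ∑ₗ before (allDigraphs N)
      ≈⟨ ∑ₗ-insertAt (subsets N) i before ⟩
    ∑ₗ (λ u → ∑ₗ (λ s → before (insertAt u i s)) (subsets N)) (vecs (subsets N) n)
      ≈⟨ ∑ₗ-cong (λ u → begin
        ∑ₗ (λ s → before (insertAt u i s)) (subsets N)
          ≈⟨ ∑ₗ-subsets N _ (λ s 2≤∣s∣ →
               trans (*-congʳ (forestWeight-¬forest Γ k (¬forest u s 2≤∣s∣))) (zeroˡ _)) ⟩
        before (insertAt u i ∅) + sum (λ m → before (insertAt u i ⁅ m ⁆))
          ≈⟨ L⊗Q-local Γ i (insertAt u i ∅) (λ m → insertAt u i ⁅ m ⁆)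
               (insertAt-lookup u i ∅) (λ m → insertAt-lookup u i ⁅ m ⁆)
               (λ m → lookup-insertAt-other u i ⁅ m ⁆ ∅) (numArcs-insertAt u) (W-insertAt u) k j ⟩
        after (insertAt u i ∅) + sum (λ m → after (insertAt u i ⁅ m ⁆))
          ≈⟨ ∑ₗ-subsets N _ (λ s 2≤∣s∣ →
               trans (*-congʳ (forestWeight-¬forest Γ (ℕ.suc k) (¬forest u s 2≤∣s∣))) (zeroˡ _)) ⟨
        ∑ₗ (λ s → after (insertAt u i s)) (subsets N) ∎) (vecs (subsets N) n) ⟩
    ∑ₗ (λ u → ∑ₗ (λ s → after (insertAt u i s)) (subsets N)) (vecs (subsets N) n)
      ≈⟨ ∑ₗ-insertAt (subsets N) i after ⟨
    ∑ₗ after (allDigraphs N)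
      ≈⟨ σI-Q-expand Γ k i j ⟨
    σ Γ (ℕ.suc k) * I i j - Q Γ (ℕ.suc k) i j ∎
    where
    open WeightedDigraph Γ renaming (weight to w)
    N = ℕ.suc n
    before = L⊗Q-summand Γ k i j
    after  = σI-Q-summand Γ k i j

    ¬forest : ∀ u s → 2 ℕ.≤ ∣ s ∣ → ¬ IsDivergingForest (insertAt u i s)
    ¬forest u s 2≤∣s∣ (_ , indegree≤1) =
      ℕ.<⇒≱ 2≤∣s∣ (≡.subst (λ t → ∣ t ∣ ℕ.≤ 1) (insertAt-lookup u i s) (indegree≤1 i))

    numArcs-insertAt : ∀ u m → numArcs (insertAt u i ⁅ m ⁆) ≡ ℕ.suc (numArcs (insertAt u i ∅))
    numArcs-insertAt u m = ≡.trans (sum-map-insertAt ∣_∣ u i ⁅ m ⁆) (≡.trans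
      (≡.cong (ℕ._+ Vec.sum (Vec.map ∣_∣ u)) (∣⁅x⁆∣≡1 m))
      (≡.cong ℕ.suc (≡.sym (≡.trans (sum-map-insertAt ∣_∣ u i ∅)
        (≡.cong (ℕ._+ Vec.sum (Vec.map ∣_∣ u)) (∣⊥∣≡0 N))))))

    W-insertAt : ∀ u m → subgraphWeight Γ (insertAt u i ⁅ m ⁆) ≈
                         w m i * subgraphWeight Γ (insertAt u i ∅)
    W-insertAt u m = begin
      subgraphWeight Γ (insertAt u i ⁅ m ⁆)
        ≈⟨ trans (subgraphWeight-insertAt Γ u i ⁅ m ⁆) (*-congʳ (rowWeight-⁅⁆ Γ i m)) ⟩
      w m i * _
        ≈⟨ *-congˡ (trans (subgraphWeight-insertAt Γ u i ∅)
             (trans (*-congʳ (rowWeight-∅ Γ i)) (*-identityˡ _))) ⟨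
      w m i * subgraphWeight Γ (insertAt u i ∅) ∎

-- Signs and sums of squares without a decidable order

module Order {c ℓ₁ ℓ₂} (ℝ : RealField c ℓ₁ ℓ₂) where
  open RealField ℝ hiding (zero)
  open OverReals ℝ
  open Algebra.Properties.CommutativeMonoid.Sum +-commutativeMonoid using (sum)
  open Algebra.Properties.Ring ring
    using (-‿distribˡ-*; -‿distribʳ-*; -‿involutive; //-rightDividesʳ)
  open Relation.Binary.Reasoning.Setoid setoid

  -- The order is not decidable, so ¬ x < 0# plays the role of 0 ≤ x.

  #-shift : ∀ {x y u v} → x - y ≈ u - v → x # y → u # v
  #-shift eq x#y with #⇒invertible x#y
  ... | z , zx≈1 , _ = invertibleˡ⇒# heytingCommutativeRing (z , trans (*-congˡ (sym eq)) zx≈1)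

  private
    x-0 : ∀ x → x - 0# ≈ x
    x-0 = x-0≈x heytingCommutativeRing

  -- By cotransitivity `y` is apart from `x + y` or from zero; in the first case subtracting `y`
  -- leaves `x` apart from zero.
  x+y#0⇒x#0⊎y#0 : ∀ {x y} → x + y # 0# → x # 0# ⊎ y # 0#
  x+y#0⇒x#0⊎y#0 {x} {y} x+y#0 = Sum.map₁
    (#-shift (trans (//-rightDividesʳ y x) (sym (x-0 x)))) (#-cotrans x+y#0 y)

  sum#0⇒# : ∀ {n} {f : Fin n → Carrier} → sum f # 0# → ∃ λ i → f i # 0#
  sum#0⇒# {ℕ.zero}  s#0 = ⊥-elim (#-irrefl refl s#0)
  sum#0⇒# {ℕ.suc n} s#0 with x+y#0⇒x#0⊎y#0 s#0
  ... | inj₁ f₀#0 = zero , f₀#0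
  ... | inj₂ s′#0 with sum#0⇒# s′#0
  ... | i , fᵢ#0 = suc i , fᵢ#0

  xy#0⇒y#0 : ∀ {x y} → x * y # 0# → y # 0#
  xy#0⇒y#0 {x} {y} xy#0 with #⇒invertible xy#0
  ... | z , zxy≈1 , _ = invertibleˡ⇒# heytingCommutativeRing (z * x , (begin
    z * x * (y - 0#)    ≈⟨ *-congˡ (x-0 y) ⟩
    z * x * y           ≈⟨ *-assoc z x y ⟩
    z * (x * y)         ≈⟨ *-congˡ (x-0 (x * y)) ⟨
    z * (x * y - 0#)    ≈⟨ zxy≈1 ⟩
    1#                  ∎))

  xy#0⇒x#0 : ∀ {x y} → x * y # 0# → x # 0#
  xy#0⇒x#0 xy#0 = xy#0⇒y#0 (#-congʳ heytingCommutativeRing (*-comm _ _) xy#0)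

  x#0⇒0<x² : ∀ {x} → x # 0# → 0# < x * x
  x#0⇒0<x² {x} x#0 with #⇒<⊎> x#0
  ... | inj₂ 0<x = *-pos 0<x 0<x
  ... | inj₁ x<0 = <-respʳ-≈ [-x]²≈x² (*-pos 0<-x 0<-x)
    where
    0<-x : 0# < - x
    0<-x = <-respˡ-≈ (-‿inverseʳ x) (<-respʳ-≈ (+-identityˡ (- x)) (+-monoˡ-< (- x) x<0))

    [-x]²≈x² : - x * - x ≈ x * x
    [-x]²≈x² = trans (sym (-‿distribˡ-* x (- x)))
      (trans (-‿cong (sym (-‿distribʳ-* x x))) (-‿involutive _))

  -- A negative square is apart from zero, hence so is `x`, which makes the square positive.
  ¬x²<0 : ∀ x → ¬ (x * x < 0#)
  ¬x²<0 x x²<0 = <-irrefl refl (<-trans (x#0⇒0<x² (xy#0⇒x#0 (<⇒# x²<0))) x²<0)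

  -- Since `x` is apart from zero, `x + y` is apart from `y`, so by cotransitivity zero is apart
  -- from one of the two. This makes its sign available, and the negative sign is refuted in either
  -- case.
  pos+nonneg : ∀ {x y} → 0# < x → ¬ (y < 0#) → 0# < x + y
  pos+nonneg {x} {y} 0<x ¬y<0
    with #-cotrans (#-shift (trans (x-0 x) (sym (//-rightDividesʳ y x))) (#-sym (<⇒# 0<x))) 0#
  ... | inj₂ 0#y = [ +-pos 0<x , ⊥-elim ∘ ¬y<0 ]′ (#⇒<⊎> 0#y)
  ... | inj₁ x+y#0 with #⇒<⊎> x+y#0
  ... | inj₂ 0<x+y = 0<x+y
  ... | inj₁ x+y<0 =
    ⊥-elim (¬y<0 (<-trans (<-respˡ-≈ (+-identityˡ y) (+-monoˡ-< y 0<x)) x+y<0))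

  nonneg+pos : ∀ {x y} → ¬ (x < 0#) → 0# < y → 0# < x + y
  nonneg+pos ¬x<0 0<y = <-respʳ-≈ (+-comm _ _) (pos+nonneg 0<y ¬x<0)

  -- A negative sum is apart from zero, so one of the summands is as well. That summand must be
  -- positive, and then so is the sum.
  nonneg+nonneg : ∀ {x y} → ¬ (x < 0#) → ¬ (y < 0#) → ¬ (x + y < 0#)
  nonneg+nonneg ¬x<0 ¬y<0 x+y<0 with x+y#0⇒x#0⊎y#0 (<⇒# x+y<0)
  ... | inj₁ x#0 = [ ¬x<0 , (λ 0<x → <-irrefl refl (<-trans (pos+nonneg 0<x ¬y<0) x+y<0)) ]′ (#⇒<⊎> x#0)
  ... | inj₂ y#0 = [ ¬y<0 , (λ 0<y → <-irrefl refl (<-trans (nonneg+pos ¬x<0 0<y) x+y<0)) ]′ (#⇒<⊎> y#0)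

  sumSquares-nonneg : ∀ {n} (x : Fin n → Carrier) → ¬ (sum (λ i → x i * x i) < 0#)
  sumSquares-nonneg {ℕ.zero}  x = <-irrefl refl
  sumSquares-nonneg {ℕ.suc n} x = nonneg+nonneg (¬x²<0 (x zero)) (sumSquares-nonneg (x ∘ suc))

  sumSquares-pos : ∀ {n} {x : Fin n → Carrier} i → x i # 0# → 0# < sum (λ i → x i * x i)
  sumSquares-pos {x = x} zero    xᵢ#0 = pos+nonneg (x#0⇒0<x² xᵢ#0) (sumSquares-nonneg (x ∘ suc))
  sumSquares-pos {x = x} (suc i) xᵢ#0 = nonneg+pos (¬x²<0 (x zero)) (sumSquares-pos i xᵢ#0)

-- Matrix algebra

module MatrixAlgebra {c ℓ₁ ℓ₂} (ℝ : RealField c ℓ₁ ℓ₂) where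
  open RealField ℝ hiding (zero)
  open OverReals ℝ
  open CommutativeRing commutativeRing using (*-commutativeSemigroup)
  open Summation commutativeRing
  open Algebra.Properties.CommutativeMonoid.Sum +-commutativeMonoid using (sum; ∑-comm)
  open Relation.Binary.Reasoning.Setoid setoid

  module _ {n : ℕ} where
    open RingSum n

    infixr 5 _⊛_
    infixl 7 _⊙_

    _⊛_ : Matrix n → (Fin n → Carrier) → Fin n → Carrier
    (A ⊛ x) i = sum λ k → A i k * x k

    _⊙_ : Matrix n → Carrier → Matrix n
    (A ⊙ x) i j = A i j * x

    0ᴹ : Matrix n
    0ᴹ _ _ = 0#

    ⊛-assoc : ∀ A B x i → (A ⊗ B ⊛ x) i ≈ (A ⊛ (B ⊛ x)) i
    ⊛-assoc A B x i = begin
      sum (λ k → sum (λ m → A i m * B m k) * x k)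
        ≈⟨ ∑-cong (λ k → trans (*-distribʳ-∑ (x k) _) (∑-cong λ m → *-assoc _ _ _)) ⟩
      sum (λ k → sum (λ m → A i m * (B m k * x k)))
        ≈⟨ ∑-comm (λ k m → A i m * (B m k * x k)) ⟩
      sum (λ m → sum (λ k → A i m * (B m k * x k)))
        ≈⟨ ∑-cong (λ m → *-distribˡ-∑ (A i m) _) ⟨
      sum (λ m → A i m * sum (λ k → B m k * x k)) ∎

    ⊛-identityˡ : ∀ x i → (I ⊛ x) i ≈ x i
    ⊛-identityˡ x i = trans
      (∑-single +-commutativeMonoid n i _ λ k≢i →
        trans (*-congʳ (reflexive (𝟙-false (i ≟ᶠ _) (k≢i ∘ ≡.sym)))) (zeroˡ _))
      (trans (*-congʳ (reflexive (𝟙-true (i ≟ᶠ i) ≡.refl))) (*-identityˡ _))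

    ⊛-distribʳ-⊕ : ∀ A B x i → (A ⊕ B ⊛ x) i ≈ (A ⊛ x) i + (B ⊛ x) i
    ⊛-distribʳ-⊕ A B x i = trans (∑-cong λ k → distribʳ _ _ _) (∑-+ _ _)

    ᵀ-adjoint : ∀ A x y → sum (λ i → x i * (A ᵀ ⊛ y) i) ≈ sum (λ i → (A ⊛ x) i * y i)
    ᵀ-adjoint A x y = begin
      sum (λ i → x i * sum (λ k → A k i * y k))
        ≈⟨ ∑-cong (λ i → trans (*-distribˡ-∑ (x i) _)
             (∑-cong λ k → trans (x∙yz≈y∙xz _ _ _) (sym (*-assoc _ _ _)))) ⟩
      sum (λ i → sum (λ k → A k i * x i * y k))
        ≈⟨ ∑-comm (λ i k → A k i * x i * y k) ⟩
      sum (λ k → sum (λ i → A k i * x i * y k))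
        ≈⟨ ∑-cong (λ k → *-distribʳ-∑ (y k) _) ⟨
      sum (λ k → sum (λ i → A k i * x i) * y k) ∎
      where open Algebra.Properties.CommutativeSemigroup *-commutativeSemigroup using (x∙yz≈y∙xz)

    ᴹ-setoid : Setoid _ _
    ᴹ-setoid = record
      { Carrier       = Matrix n
      ; _≈_           = _≈ᴹ_
      ; isEquivalence = record
        { refl  = λ i j → refl
        ; sym   = λ A≈B i j → sym (A≈B i j)
        ; trans = λ A≈B B≈C i j → trans (A≈B i j) (B≈C i j)
        }
      }

    ⊗-cong : ∀ {A B C D : Matrix n} → A ≈ᴹ B → C ≈ᴹ D → A ⊗ C ≈ᴹ B ⊗ D
    ⊗-cong A≈B C≈D i j = ∑-cong λ k → *-cong (A≈B i k) (C≈D k j)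

    ⊗-congˡ : ∀ {A C D : Matrix n} → C ≈ᴹ D → A ⊗ C ≈ᴹ A ⊗ D
    ⊗-congˡ C≈D i j = ∑-cong λ k → *-congˡ (C≈D k j)

    ⊗-congʳ : ∀ {A B C : Matrix n} → A ≈ᴹ B → A ⊗ C ≈ᴹ B ⊗ C
    ⊗-congʳ A≈B i j = ∑-cong λ k → *-congʳ (A≈B i k)

    ⊕-cong : ∀ {A B C D : Matrix n} → A ≈ᴹ B → C ≈ᴹ D → A ⊕ C ≈ᴹ B ⊕ D
    ⊕-cong A≈B C≈D i j = +-cong (A≈B i j) (C≈D i j)

    ᵀ-cong : ∀ {A B : Matrix n} → A ≈ᴹ B → A ᵀ ≈ᴹ B ᵀ
    ᵀ-cong A≈B i j = A≈B j i

    ⊗-assoc : ∀ (A B C : Matrix n) → A ⊗ B ⊗ C ≈ᴹ A ⊗ (B ⊗ C)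
    ⊗-assoc A B C i j = ⊛-assoc A B (λ k → C k j) i

    ⊗-ᵀ : ∀ (A B : Matrix n) → (A ⊗ B) ᵀ ≈ᴹ B ᵀ ⊗ A ᵀ
    ⊗-ᵀ A B i j = ∑-cong λ k → *-comm _ _

    I-ᵀ : I {n} ᵀ ≈ᴹ I
    I-ᵀ i j = reflexive (𝟙-cong (j ≟ᶠ i) (i ≟ᶠ j) ≡.sym ≡.sym)

    ⊗-identityˡ : ∀ (A : Matrix n) → I ⊗ A ≈ᴹ A
    ⊗-identityˡ A i j = ⊛-identityˡ (λ k → A k j) i

    ⊗-identityʳ : ∀ (A : Matrix n) → A ⊗ I ≈ᴹ A
    ⊗-identityʳ A i j = trans
      (∑-cong λ k → trans (*-comm _ _) (*-congʳ (sym (I-ᵀ k j))))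
      (⊗-identityˡ (A ᵀ) j i)

    ⊗-zeroʳ : ∀ (A : Matrix n) → A ⊗ 0ᴹ ≈ᴹ 0ᴹ
    ⊗-zeroʳ A i j = ∑-zero λ k → zeroʳ _

    ⊕-identityˡ : ∀ (A : Matrix n) → 0ᴹ ⊕ A ≈ᴹ A
    ⊕-identityˡ A i j = +-identityˡ _

    ⊕-identityʳ : ∀ (A : Matrix n) → A ⊕ 0ᴹ ≈ᴹ A
    ⊕-identityʳ A i j = +-identityʳ _

    ⊗-distribʳ-⊕ : ∀ (A B C : Matrix n) → (A ⊕ B) ⊗ C ≈ᴹ A ⊗ C ⊕ B ⊗ C
    ⊗-distribʳ-⊕ A B C i j = ⊛-distribʳ-⊕ A B (λ k → C k j) i

    ⊗-distribˡ-⊕ : ∀ (A B C : Matrix n) → A ⊗ (B ⊕ C) ≈ᴹ A ⊗ B ⊕ A ⊗ C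
    ⊗-distribˡ-⊕ A B C i j = trans (∑-cong λ k → distribˡ _ _ _) (∑-+ _ _)

    ⊙-⊗ : ∀ (A B : Matrix n) x → A ⊙ x ⊗ B ≈ᴹ (A ⊗ B) ⊙ x
    ⊙-⊗ A B x i j = trans (∑-cong λ k → xy∙z≈xz∙y _ _ _) (sym (*-distribʳ-∑ x _))
      where open Algebra.Properties.CommutativeSemigroup *-commutativeSemigroup using (xy∙z≈xz∙y)

    ⊗-⊙ : ∀ (A B : Matrix n) x → A ⊗ (B ⊙ x) ≈ᴹ (A ⊗ B) ⊙ x
    ⊗-⊙ A B x i j = trans (∑-cong λ k → sym (*-assoc _ _ _)) (sym (*-distribʳ-∑ x _))

-- Positive definite systems and elimination

module PositiveDefinite {c ℓ₁ ℓ₂} (ℝ : RealField c ℓ₁ ℓ₂) where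
  open RealField ℝ hiding (zero)
  open OverReals ℝ
  open Order ℝ
  open MatrixAlgebra ℝ
  open Summation commutativeRing
  open Algebra.Properties.CommutativeMonoid.Sum +-commutativeMonoid using (sum)
  open Algebra.Properties.Ring ring
    using (x[y-z]≈xy-xz; [y-z]x≈yx-zx; //-rightDividesˡ)
  open Relation.Binary.Reasoning.Setoid setoid

  PosDef : ∀ {n} → Matrix n → Set _
  PosDef A = ∀ x i → x i # 0# → 0# < sum λ k → x k * (A ⊛ x) k

  module Schur {n} (A : Matrix (ℕ.suc n)) (t : Carrier) (at≈1 : A zero zero * t ≈ 1#) where
    open RingSum n

    schur : Matrix n
    schur k l = A (suc k) (suc l) - A (suc k) zero * (t * A zero (suc l))

    module _ (β : Carrier) (y : Fin n → Carrier) where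
      private
        s : Carrier
        s = sum λ l → A zero (suc l) * y l

      -- Back substitution: the first coordinate is the one that makes the first entry of
      -- `A ⊛ extend` equal to `β`.
      extend : Fin (ℕ.suc n) → Carrier
      extend zero    = t * (β - s)
      extend (suc k) = y k

      extend-zero : (A ⊛ extend) zero ≈ β
      extend-zero = begin
        A zero zero * (t * (β - s)) + s   ≈⟨ +-congʳ (*-assoc _ _ _) ⟨
        A zero zero * t * (β - s) + s     ≈⟨ +-congʳ (trans (*-congʳ at≈1) (*-identityˡ _)) ⟩
        β - s + s                         ≈⟨ //-rightDividesˡ s β ⟩
        β                                 ∎

      schur-⊛ : ∀ k → (schur ⊛ y) k ≈
                sum (λ l → A (suc k) (suc l) * y l) - A (suc k) zero * (t * s)
      schur-⊛ k = begin
        sum (λ l → (A (suc k) (suc l) - A (suc k) zero * (t * A zero (suc l))) * y l)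
          ≈⟨ ∑-cong (λ l → trans ([y-z]x≈yx-zx _ _ _)
               (+-congˡ (-‿cong (trans (*-assoc _ _ _) (*-congˡ (*-assoc _ _ _)))))) ⟩
        sum (λ l → A (suc k) (suc l) * y l - A (suc k) zero * (t * (A zero (suc l) * y l)))
          ≈⟨ ∑-- _ _ ⟩
        sum (λ l → A (suc k) (suc l) * y l) - sum (λ l → A (suc k) zero * (t * (A zero (suc l) * y l)))
          ≈⟨ +-congˡ (-‿cong (trans (*-congˡ (*-distribˡ-∑ t _)) (*-distribˡ-∑ (A (suc k) zero) _))) ⟨
        sum (λ l → A (suc k) (suc l) * y l) - A (suc k) zero * (t * s) ∎

      extend-suc : ∀ k → (A ⊛ extend) (suc k) ≈ A (suc k) zero * (t * β) + (schur ⊛ y) k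
      extend-suc k = begin
        a * (t * (β - s)) + σ           ≈⟨ +-congʳ (trans (*-congˡ (x[y-z]≈xy-xz _ _ _)) (x[y-z]≈xy-xz _ _ _)) ⟩
        a * (t * β) - a * (t * s) + σ   ≈⟨ trans (+-assoc _ _ _) (+-congˡ (+-comm _ _)) ⟩
        a * (t * β) + (σ - a * (t * s)) ≈⟨ +-congˡ (schur-⊛ k) ⟨
        a * (t * β) + (schur ⊛ y) k     ∎
        where
        a = A (suc k) zero
        σ = sum λ l → A (suc k) (suc l) * y l

    -- Extending `y` with `β` equal to zero makes the first entry of the image vanish and the others
    -- agree with `schur ⊛ y`, so both quadratic forms take the same value.
    schur-posDef : PosDef A → PosDef schur
    schur-posDef posDef y i yᵢ#0 = <-respʳ-≈ (begin
      x zero * (A ⊛ x) zero + sum (λ k → y k * (A ⊛ x) (suc k))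
        ≈⟨ +-cong (trans (*-congˡ (extend-zero 0# y)) (zeroʳ _))
             (∑-cong λ k → *-congˡ (trans (extend-suc 0# y k)
               (trans (+-congʳ (trans (*-congˡ (zeroʳ t)) (zeroʳ _))) (+-identityˡ _)))) ⟩
      0# + sum (λ k → y k * (schur ⊛ y) k)
        ≈⟨ +-identityˡ _ ⟩
      sum (λ k → y k * (schur ⊛ y) k) ∎) (posDef x (suc i) yᵢ#0)
      where x = extend 0# y

  -- The pivot is the value of the quadratic form at the first unit vector.
  posDef⇒pivot-pos : ∀ {n} {A : Matrix (ℕ.suc n)} → PosDef A → 0# < A zero zero
  posDef⇒pivot-pos {n} {A} posDef = <-respʳ-≈ (begin
    1# * (A zero zero * 1# + sum (λ l → A zero (suc l) * 0#)) + sum (λ k → 0# * (A ⊛ e) (suc k))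
      ≈⟨ +-cong (trans (*-identityˡ _) (+-cong (*-identityʳ _) (∑-zero λ _ → zeroʳ _)))
                (∑-zero λ _ → zeroˡ _) ⟩
    A zero zero + 0# + 0#
      ≈⟨ trans (+-identityʳ _) (+-identityʳ _) ⟩
    A zero zero ∎) (posDef e zero (1#0 heytingCommutativeRing))
    where
    open RingSum n
    e : Fin (ℕ.suc n) → Carrier
    e zero    = 1#
    e (suc _) = 0#

  posDef⇒solvable : ∀ {n} (A : Matrix n) → PosDef A → ∀ (b : Fin n → Carrier) →
                    ∃ λ x → ∀ i → (A ⊛ x) i ≈ b i
  posDef⇒solvable {ℕ.zero}  A posDef b = (λ ()) , λ ()
  posDef⇒solvable {ℕ.suc n} A posDef b with pos⇒invertible (posDef⇒pivot-pos {A = A} posDef)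
  ... | t , _ , at≈1 with posDef⇒solvable (Schur.schur A t at≈1) (Schur.schur-posDef A t at≈1 posDef)
                            -- The right-hand side that is left once the first unknown has been
                            -- eliminated.
                            (λ k → b (suc k) - A (suc k) zero * (t * b zero))
  ... | y , Sy≈b = extend (b zero) y , λ where
      zero    → extend-zero (b zero) y
      (suc k) → begin
        (A ⊛ extend (b zero) y) (suc k)                     ≈⟨ extend-suc (b zero) y k ⟩
        A (suc k) zero * (t * b zero) + (schur ⊛ y) k       ≈⟨ +-congˡ (Sy≈b k) ⟩
        A (suc k) zero * (t * b zero) + (b (suc k) - A (suc k) zero * (t * b zero))
                                                            ≈⟨ +-comm _ _ ⟩
        b (suc k) - A (suc k) zero * (t * b zero) + A (suc k) zero * (t * b zero)
                                                            ≈⟨ //-rightDividesˡ _ _ ⟩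
        b (suc k)                                           ∎
    where open Schur A t at≈1

-- Maximum out forests and the matrix of their weights

sum≡0⇒lookup≡0 : ∀ {n} (v : Vec ℕ n) → Vec.sum v ≡ 0 → ∀ i → lookup v i ≡ 0
sum≡0⇒lookup≡0 (x ∷ v) eq zero    = ℕ.m+n≡0⇒m≡0 x eq
sum≡0⇒lookup≡0 (x ∷ v) eq (suc i) = sum≡0⇒lookup≡0 v (ℕ.m+n≡0⇒n≡0 x eq) i

numArcs≡0⇒isRoot : ∀ {n} (G : Digraph n) → numArcs G ≡ 0 → ∀ i → IsRoot G i
numArcs≡0⇒isRoot G eq i =
  ≡.trans (≡.sym (lookup-map i ∣_∣ G)) (sum≡0⇒lookup≡0 (Vec.map ∣_∣ G) eq i)

module MaximumForests {c ℓ₁ ℓ₂} (ℝ : RealField c ℓ₁ ℓ₂) {n : ℕ}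
  (Γ : OverReals.WeightedDigraph ℝ n) where
  open RealField ℝ hiding (zero)
  open OverReals ℝ
  open WeightedDigraph Γ renaming (weight to w)
  open CommutativeRing commutativeRing using (*-commutativeSemigroup)
  open Summation commutativeRing
  open Forests ℝ
  open MatrixAlgebra ℝ
  open Algebra.Properties.CommutativeMonoid.Sum *-commutativeMonoid
    using () renaming (sum to product)
  open Algebra.Properties.Ring ring
    using (//-rightDividesˡ; +-cancelˡ)
  open Algebra.Properties.CommutativeSemigroup *-commutativeSemigroup using (x∙yz≈y∙xz)
  open Relation.Binary.Reasoning.Setoid setoid

  private
    W = subgraphWeight Γ
    L = kirchhoff Γ
    Fs = allDigraphs n

  product-zero : ∀ {m} {f : Fin m → Carrier} i → f i ≈ 0# → product f ≈ 0#
  product-zero zero    fᵢ≈0 = trans (*-congʳ fᵢ≈0) (zeroˡ _)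
  product-zero (suc i) fᵢ≈0 = trans (*-congˡ (product-zero i fᵢ≈0)) (zeroʳ _)

  -- An arc of `G` that is missing in `arcs` contributes a factor zero. Hence sums over all
  -- diverging forests may stand for sums over out forests.
  ⊑⊎weightless : ∀ G → G ⊑ arcs ⊎ W G ≈ 0#
  ⊑⊎weightless G with any? (λ i → any? λ j → arc? G i j ×-dec ¬? (arc? arcs i j))
  ... | no none = inj₁ λ j {i} i→j →
        decidable-stable (arc? arcs i j) λ ¬i→j → none (i , j , i→j , ¬i→j)
  ... | yes (i , j , i→j , ¬i→j) = inj₂ (product-zero i (product-zero j factor))
    where
    factor : (if ⌊ arc? G i j ⌋ then w i j else 1#) ≈ 0#
    factor with arc? G i j
    ... | yes _     = ¬arc⇒≈0 ¬i→j
    ... | no ¬i→j′ = ⊥-elim (¬i→j′ i→j)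

  private
    best : ∃ λ F → IsMaximumOutForest arcs F
    best with maximumOutForest-exists arcs
    ... | F , F∈ = F , proj₂ (∈-filter⁻ (isMaximumOutForest? arcs) {xs = Fs} F∈)

  maxArcs : ℕ
  maxArcs = numArcs (proj₁ best)

  maximum⇒size : ∀ {G} → IsMaximumOutForest arcs G → IsDivergingForest G × numArcs G ≡ maxArcs
  maximum⇒size {G} (outG@(_ , forestG) , maxG) =
    forestG , ℕ.≤-antisym (proj₂ (proj₂ best) G outG) (maxG (proj₁ best) (proj₁ (proj₂ best)))

  size⇒maximum : ∀ {G} → G ⊑ arcs → IsDivergingForest G × numArcs G ≡ maxArcs →
                 IsMaximumOutForest arcs G
  size⇒maximum {G} G⊑Γ (forestG , eq) = (G⊑Γ , forestG) , λ H outH →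
    ≡.subst (numArcs H ℕ.≤_) (≡.sym eq) (proj₂ (proj₂ best) H outH)

  -- Inside `arcs` the maximum out forests are exactly the diverging forests with `maxArcs` arcs;
  -- elsewhere both sides vanish with the weight.
  maximum-weight : ∀ G → 𝟙 (isMaximumOutForest? arcs G) * W G ≈ forestWeight Γ maxArcs G
  maximum-weight G = trans (eq (⊑⊎weightless G)) (sym (reflexive (forestWeight-def Γ maxArcs G)))
    where
    eq : G ⊑ arcs ⊎ W G ≈ 0# →
         𝟙 (isMaximumOutForest? arcs G) * W G ≈ 𝟙 (isForestOfSize? Γ maxArcs G) * W G
    eq (inj₁ G⊑Γ) = *-congʳ (reflexive (𝟙-cong (isMaximumOutForest? arcs G)
      (isForestOfSize? Γ maxArcs G) (maximum⇒size {G}) (size⇒maximum {G} G⊑Γ)))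
    eq (inj₂ W≈0) = trans (*-congˡ W≈0) (trans (zeroʳ _) (sym (trans (*-congˡ W≈0) (zeroʳ _))))

  weightOf-maximum : weightOf Γ (maximumOutForests arcs) ≈ σ Γ maxArcs
  weightOf-maximum = trans (∑ₗ-filter (isMaximumOutForest? arcs) W Fs) (∑ₗ-cong maximum-weight Fs)

  weightOf-maximumAt : ∀ i j → weightOf Γ (maximumOutForestsAt arcs j i) ≈ Q Γ maxArcs i j
  weightOf-maximumAt i j = begin
    weightOf Γ (maximumOutForestsAt arcs j i)
      ≈⟨ ∑ₗ-filter (λ F → inTreeRootedAt? F j i) W (maximumOutForests arcs) ⟩
    ∑ₗ (λ F → 𝟙 (inTreeRootedAt? F j i) * W F) (maximumOutForests arcs)
      ≈⟨ ∑ₗ-filter (isMaximumOutForest? arcs) _ Fs ⟩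
    ∑ₗ (λ F → 𝟙 (isMaximumOutForest? arcs F) * (𝟙 (inTreeRootedAt? F j i) * W F)) Fs
      ≈⟨ ∑ₗ-cong (λ F → trans (x∙yz≈y∙xz _ _ _) (trans (*-comm _ _) (*-cong (maximum-weight F)
           (reflexive (≡.sym (inTree-def F i j)))))) Fs ⟩
    Q Γ maxArcs i j ∎

  -- A forest inside `arcs` has at most `maxArcs` arcs, and a digraph not inside `arcs` has weight
  -- zero.
  tooLarge : ∀ G → forestWeight Γ (ℕ.suc maxArcs) G ≈ 0#
  tooLarge G = trans (reflexive (forestWeight-def Γ (ℕ.suc maxArcs) G)) (eq (⊑⊎weightless G))
    where
    eq : G ⊑ arcs ⊎ W G ≈ 0# → 𝟙 (isForestOfSize? Γ (ℕ.suc maxArcs) G) * W G ≈ 0#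
    eq (inj₁ G⊑Γ) = trans (*-congʳ (reflexive (𝟙-false (isForestOfSize? Γ (ℕ.suc maxArcs) G)
      λ (forestG , eq) → ℕ.1+n≰n (≡.subst (ℕ._≤ maxArcs) eq (proj₂ (proj₂ best) G (G⊑Γ , forestG))))))
      (zeroˡ _)
    eq (inj₂ W≈0) = trans (*-congˡ W≈0) (zeroʳ _)

  -- Without arcs every vertex is the root of a tree of its own and reaches no other vertex.
  Q-zero : Q Γ 0 ≈ᴹ I ⊙ σ Γ 0
  Q-zero i j = trans (∑ₗ-cong term Fs) (sym (*-distribˡ-∑ₗ (I i j) _ Fs))
    where
    term : ∀ F → forestWeight Γ 0 F * inTree F i j ≈ I i j * forestWeight Γ 0 F
    term F with numArcs F ℕ.≟ 0
    ... | yes eq = trans (*-comm _ _) (*-congʳ (reflexive (≡.trans (inTree-def F i j)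
      (𝟙-cong (inTreeRootedAt? F j i) (i ≟ᶠ j) to from))))
      where
      isRoot : ∀ i → IsRoot F i
      isRoot = numArcs≡0⇒isRoot F eq

      to : InTreeRootedAt F j i → i ≡ j
      to t = ≡.sym (root-unique F (λ k → ℕ.≤-trans (ℕ.≤-reflexive (isRoot k)) ℕ.z≤n) (isRoot i) ε t)

      from : i ≡ j → InTreeRootedAt F j i
      from ≡.refl = path⇒inTree F (isRoot i) ε
    ... | no neq = trans (trans (*-congʳ vanish) (zeroˡ _)) (sym (trans (*-congˡ vanish) (zeroʳ _)))
      where
      vanish : forestWeight Γ 0 F ≈ 0#
      vanish = trans (reflexive (forestWeight-def Γ 0 F))
        (trans (*-congʳ (reflexive (𝟙-false (isForestOfSize? Γ 0 F) (neq ∘ proj₂)))) (zeroˡ _))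

  Q-suc : ∀ k → Q Γ (ℕ.suc k) ⊕ L ⊗ Q Γ k ≈ᴹ I ⊙ σ Γ (ℕ.suc k)
  Q-suc k i j = begin
    Q Γ (ℕ.suc k) i j + (L ⊗ Q Γ k) i j
      ≈⟨ +-congˡ (L⊗Q Γ k i j) ⟩
    Q Γ (ℕ.suc k) i j + (σ Γ (ℕ.suc k) * I i j - Q Γ (ℕ.suc k) i j)
      ≈⟨ +-comm _ _ ⟩
    σ Γ (ℕ.suc k) * I i j - Q Γ (ℕ.suc k) i j + Q Γ (ℕ.suc k) i j
      ≈⟨ //-rightDividesˡ _ _ ⟩
    σ Γ (ℕ.suc k) * I i j
      ≈⟨ *-comm _ _ ⟩
    I i j * σ Γ (ℕ.suc k) ∎

  I⊙-central : ∀ (A : Matrix n) x → A ⊗ (I ⊙ x) ≈ᴹ I ⊙ x ⊗ A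
  I⊙-central A x i j = begin
    (A ⊗ (I ⊙ x)) i j  ≈⟨ ⊗-⊙ A I x i j ⟩
    (A ⊗ I) i j * x    ≈⟨ *-congʳ (trans (⊗-identityʳ A i j) (sym (⊗-identityˡ A i j))) ⟩
    (I ⊗ A) i j * x    ≈⟨ ⊙-⊗ I A x i j ⟨
    (I ⊙ x ⊗ A) i j    ∎

  -- By Q-suc each Q k is a polynomial in L.
  L-Q-comm : ∀ k → L ⊗ Q Γ k ≈ᴹ Q Γ k ⊗ L
  L-Q-comm ℕ.zero i j = begin
    (L ⊗ Q Γ 0) i j          ≈⟨ ⊗-congˡ {A = L} Q-zero i j ⟩
    (L ⊗ (I ⊙ σ Γ 0)) i j    ≈⟨ I⊙-central L (σ Γ 0) i j ⟩
    (I ⊙ σ Γ 0 ⊗ L) i j      ≈⟨ ⊗-congʳ {C = L} Q-zero i j ⟨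
    (Q Γ 0 ⊗ L) i j          ∎
  L-Q-comm (ℕ.suc k) i j = +-cancelˡ _ _ _ (begin
    (L ⊗ (L ⊗ Q Γ k)) i j + (L ⊗ Q′) i j  ≈⟨ +-comm _ _ ⟩
    (L ⊗ Q′) i j + (L ⊗ (L ⊗ Q Γ k)) i j  ≈⟨ ⊗-distribˡ-⊕ L Q′ (L ⊗ Q Γ k) i j ⟨
    (L ⊗ (Q′ ⊕ L ⊗ Q Γ k)) i j            ≈⟨ ⊗-congˡ {A = L} (Q-suc k) i j ⟩
    (L ⊗ (I ⊙ σ Γ (ℕ.suc k))) i j         ≈⟨ I⊙-central L _ i j ⟩
    (I ⊙ σ Γ (ℕ.suc k) ⊗ L) i j           ≈⟨ ⊗-congʳ {C = L} (Q-suc k) i j ⟨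
    ((Q′ ⊕ L ⊗ Q Γ k) ⊗ L) i j            ≈⟨ ⊗-distribʳ-⊕ Q′ (L ⊗ Q Γ k) L i j ⟩
    (Q′ ⊗ L) i j + (L ⊗ Q Γ k ⊗ L) i j    ≈⟨ +-comm _ _ ⟩
    (L ⊗ Q Γ k ⊗ L) i j + (Q′ ⊗ L) i j    ≈⟨ +-congʳ (trans (⊗-assoc L (Q Γ k) L i j)
                                                (⊗-congˡ {A = L} (λ i j → sym (L-Q-comm k i j)) i j)) ⟩
    (L ⊗ (L ⊗ Q Γ k)) i j + (Q′ ⊗ L) i j  ∎)
    where Q′ = Q Γ (ℕ.suc k)

  L-Q-max : L ⊗ Q Γ maxArcs ≈ᴹ 0ᴹ
  L-Q-max i j = begin
    (L ⊗ Q Γ maxArcs) i j  ≈⟨ L⊗Q Γ maxArcs i j ⟩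
    σ Γ (ℕ.suc maxArcs) * I i j - Q Γ (ℕ.suc maxArcs) i j
      ≈⟨ +-cong (trans (*-congʳ (∑ₗ-zero tooLarge Fs)) (zeroˡ _))
           (-‿cong (∑ₗ-zero (λ F → trans (*-congʳ (tooLarge F)) (zeroˡ _)) Fs)) ⟩
    0# - 0#                ≈⟨ -‿inverseʳ 0# ⟩
    0#                     ∎

  private
    t : Carrier
    t = proj₁ (totalWeight-invertible Γ)

    J = J̄ Γ

    σt≈1 : σ Γ maxArcs * t ≈ 1#
    σt≈1 = trans (*-congʳ (sym weightOf-maximum)) (proj₂ (proj₂ (totalWeight-invertible Γ)))

  J̄-Q : J ≈ᴹ Q Γ maxArcs ⊙ t
  J̄-Q i j = *-congʳ (weightOf-maximumAt i j)

  L⊗J̄ : L ⊗ J ≈ᴹ 0ᴹ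
  L⊗J̄ i j = begin
    (L ⊗ J) i j                 ≈⟨ ⊗-congˡ {A = L} J̄-Q i j ⟩
    (L ⊗ (Q Γ maxArcs ⊙ t)) i j ≈⟨ ⊗-⊙ L (Q Γ maxArcs) t i j ⟩
    (L ⊗ Q Γ maxArcs) i j * t   ≈⟨ *-congʳ (L-Q-max i j) ⟩
    0# * t                      ≈⟨ zeroˡ t ⟩
    0#                          ∎

  J̄⊗L : J ⊗ L ≈ᴹ 0ᴹ
  J̄⊗L i j = begin
    (J ⊗ L) i j                 ≈⟨ ⊗-congʳ {C = L} J̄-Q i j ⟩
    (Q Γ maxArcs ⊙ t ⊗ L) i j   ≈⟨ ⊙-⊗ (Q Γ maxArcs) L t i j ⟩
    (Q Γ maxArcs ⊗ L) i j * t   ≈⟨ *-congʳ (trans (sym (L-Q-comm maxArcs i j)) (L-Q-max i j)) ⟩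
    0# * t                      ≈⟨ zeroˡ t ⟩
    0#                          ∎

  -- If `maxArcs` is `ℕ.suc k`, the recurrence `Q-suc k` divided by the total weight gives
  -- `Q Γ k ⊙ t` for `M`. If `maxArcs` is zero, `J` is the identity matrix, and `M` is zero.
  I-J̄∈imageOfL : ∃ λ M → L ⊗ M ⊕ J ≈ᴹ I
  I-J̄∈imageOfL = image maxArcs ≡.refl
    where
    I⊙σ⊙t : ∀ i j → I i j * σ Γ maxArcs * t ≈ I i j
    I⊙σ⊙t i j = trans (*-assoc _ _ _) (trans (*-congˡ σt≈1) (*-identityʳ _))

    image : ∀ k → k ≡ maxArcs → ∃ λ M → L ⊗ M ⊕ J ≈ᴹ I
    image ℕ.zero eq = 0ᴹ , λ i j → begin
      (L ⊗ 0ᴹ) i j + J i j       ≈⟨ +-cong (⊗-zeroʳ L i j) (J̄-Q i j) ⟩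
      0# + Q Γ maxArcs i j * t   ≈⟨ +-identityˡ _ ⟩
      Q Γ maxArcs i j * t        ≈⟨ *-congʳ (≡.subst (λ k → Q Γ k i j ≈ I i j * σ Γ k) eq (Q-zero i j)) ⟩
      I i j * σ Γ maxArcs * t    ≈⟨ I⊙σ⊙t i j ⟩
      I i j                      ∎
    image (ℕ.suc k) eq = Q Γ k ⊙ t , λ i j → begin
      (L ⊗ (Q Γ k ⊙ t)) i j + J i j                  ≈⟨ +-cong (⊗-⊙ L (Q Γ k) t i j) (J̄-Q i j) ⟩
      (L ⊗ Q Γ k) i j * t + Q Γ maxArcs i j * t      ≈⟨ distribʳ t _ _ ⟨
      ((L ⊗ Q Γ k) i j + Q Γ maxArcs i j) * t        ≈⟨ *-congʳ (+-comm _ _) ⟩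
      (Q Γ maxArcs i j + (L ⊗ Q Γ k) i j) * t
        ≈⟨ *-congʳ (≡.subst (λ m → Q Γ m i j + (L ⊗ Q Γ k) i j ≈ I i j * σ Γ m) eq (Q-suc k i j)) ⟩
      I i j * σ Γ maxArcs * t                        ≈⟨ I⊙σ⊙t i j ⟩
      I i j                                          ∎

-- Moore-Penrose inverses from Gram sums

module MoorePenrose {c ℓ₁ ℓ₂} (ℝ : RealField c ℓ₁ ℓ₂) {n : ℕ} where
  open RealField ℝ hiding (zero; refl; sym; trans; setoid)
  private module F = RealField ℝ
  open OverReals ℝ
  open Summation commutativeRing
  open RingSum n
  open MatrixAlgebra ℝ
  open PositiveDefinite ℝ
  open Order ℝ
  open Algebra.Properties.CommutativeMonoid.Sum +-commutativeMonoid using (sum)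
  open Setoid (ᴹ-setoid {n}) using (refl; sym; trans)
  private module ≈-Reasoning = Relation.Binary.Reasoning.Setoid F.setoid

  gram-quadratic : ∀ (B : Matrix n) x →
    sum (λ i → x i * (B ᵀ ⊗ B ⊛ x) i) ≈ sum (λ i → (B ⊛ x) i * (B ⊛ x) i)
  gram-quadratic B x = F.trans (∑-cong λ i → *-congˡ (⊛-assoc (B ᵀ) B x i)) (ᵀ-adjoint B x (B ⊛ x))

  -- The sum `xx#0` equals `x · x` and is therefore apart from zero. So some coordinate of `L ᵀ ⊛ x`
  -- or of `J ⊛ x` is apart from zero, and the corresponding sum of squares in `quadratic` is
  -- positive.
  gramSum-posDef : ∀ {L J M : Matrix n} → L ⊗ M ⊕ J ≈ᴹ I → PosDef (J ᵀ ⊗ J ⊕ L ⊗ L ᵀ)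
  gramSum-posDef {L} {J} {M} LM+J≈I x i xᵢ#0 = <-respʳ-≈ (F.sym quadratic) (split xx#0)
    where
    open ≈-Reasoning

    quadratic : sum (λ k → x k * (J ᵀ ⊗ J ⊕ L ⊗ L ᵀ ⊛ x) k) ≈
                sum (λ k → (J ⊛ x) k * (J ⊛ x) k) + sum (λ k → (L ᵀ ⊛ x) k * (L ᵀ ⊛ x) k)
    quadratic = begin
      sum (λ k → x k * (J ᵀ ⊗ J ⊕ L ⊗ L ᵀ ⊛ x) k)
        ≈⟨ ∑-cong (λ k → F.trans (*-congˡ (⊛-distribʳ-⊕ (J ᵀ ⊗ J) (L ⊗ L ᵀ) x k)) (distribˡ _ _ _)) ⟩
      sum (λ k → x k * (J ᵀ ⊗ J ⊛ x) k + x k * (L ⊗ L ᵀ ⊛ x) k)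
        ≈⟨ ∑-+ _ _ ⟩
      sum (λ k → x k * (J ᵀ ⊗ J ⊛ x) k) + sum (λ k → x k * (L ⊗ L ᵀ ⊛ x) k)
        ≈⟨ +-cong (gram-quadratic J x) (gram-quadratic (L ᵀ) x) ⟩
      sum (λ k → (J ⊛ x) k * (J ⊛ x) k) + sum (λ k → (L ᵀ ⊛ x) k * (L ᵀ ⊛ x) k) ∎

    xx#0 : sum (λ k → (L ᵀ ⊛ x) k * (M ⊛ x) k) + sum (λ k → x k * (J ⊛ x) k) # 0#
    xx#0 = #-congʳ heytingCommutativeRing (begin
      sum (λ k → x k * x k)
        ≈⟨ ∑-cong (λ k → *-congˡ (⊛-identityˡ x k)) ⟨
      sum (λ k → x k * (I ⊛ x) k)
        ≈⟨ ∑-cong (λ k → *-congˡ (∑-cong λ l → *-congʳ (LM+J≈I k l))) ⟨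
      sum (λ k → x k * (L ⊗ M ⊕ J ⊛ x) k)
        ≈⟨ ∑-cong (λ k → F.trans (*-congˡ (F.trans (⊛-distribʳ-⊕ (L ⊗ M) J x k)
             (+-congʳ (⊛-assoc L M x k)))) (distribˡ _ _ _)) ⟩
      sum (λ k → x k * (L ⊛ (M ⊛ x)) k + x k * (J ⊛ x) k)
        ≈⟨ ∑-+ _ _ ⟩
      sum (λ k → x k * (L ⊛ (M ⊛ x)) k) + sum (λ k → x k * (J ⊛ x) k)
        ≈⟨ +-congʳ (ᵀ-adjoint (L ᵀ) x (M ⊛ x)) ⟩
      sum (λ k → (L ᵀ ⊛ x) k * (M ⊛ x) k) + sum (λ k → x k * (J ⊛ x) k) ∎)
      (#-sym (<⇒# (sumSquares-pos {x = x} i xᵢ#0)))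

    split : sum (λ k → (L ᵀ ⊛ x) k * (M ⊛ x) k) + sum (λ k → x k * (J ⊛ x) k) # 0# →
            0# F.< sum (λ k → (J ⊛ x) k * (J ⊛ x) k) + sum (λ k → (L ᵀ ⊛ x) k * (L ᵀ ⊛ x) k)
    split s#0 with x+y#0⇒x#0⊎y#0 s#0
    ... | inj₁ l#0 with sum#0⇒# l#0
    ... | k , p#0 = nonneg+pos (sumSquares-nonneg (J ⊛ x)) (sumSquares-pos {x = L ᵀ ⊛ x} k (xy#0⇒x#0 p#0))
    split s#0 | inj₂ j#0 with sum#0⇒# j#0
    ... | k , p#0 = pos+nonneg (sumSquares-pos {x = J ⊛ x} k (xy#0⇒y#0 p#0)) (sumSquares-nonneg (L ᵀ ⊛ x))

  open Relation.Binary.Reasoning.Setoid (ᴹ-setoid {n})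

  -- The product `X ᵀ ⊗ A ⊗ X` is evaluated in two ways. In `posDef⇒invertible` this turns a right
  -- inverse into a two-sided one.
  inverse-symmetric : ∀ {A X : Matrix n} → A ᵀ ≈ᴹ A → A ⊗ X ≈ᴹ I → X ᵀ ≈ᴹ X
  inverse-symmetric {A} {X} Aᵀ≈A AX≈I = begin
    X ᵀ              ≈⟨ ⊗-identityʳ (X ᵀ) ⟨
    X ᵀ ⊗ I          ≈⟨ ⊗-congˡ AX≈I ⟨
    X ᵀ ⊗ (A ⊗ X)    ≈⟨ ⊗-assoc (X ᵀ) A X ⟨
    X ᵀ ⊗ A ⊗ X      ≈⟨ ⊗-congʳ (⊗-congˡ Aᵀ≈A) ⟨
    X ᵀ ⊗ A ᵀ ⊗ X    ≈⟨ ⊗-congʳ (⊗-ᵀ A X) ⟨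
    (A ⊗ X) ᵀ ⊗ X    ≈⟨ ⊗-congʳ (ᵀ-cong AX≈I) ⟩
    I ᵀ ⊗ X          ≈⟨ ⊗-congʳ I-ᵀ ⟩
    I ⊗ X            ≈⟨ ⊗-identityˡ X ⟩
    X                ∎

  posDef⇒invertible : ∀ {A : Matrix n} → A ᵀ ≈ᴹ A → PosDef A → Invertible A
  posDef⇒invertible {A} Aᵀ≈A posDef = X , XA≈I , AX≈I
    where
    X : Matrix n
    -- Column `j` solves the system whose right-hand side is the `j`-th unit vector.
    X i j = proj₁ (posDef⇒solvable A posDef λ k → I k j) i

    AX≈I : A ⊗ X ≈ᴹ I
    AX≈I i j = proj₂ (posDef⇒solvable A posDef λ k → I k j) i

    XA≈I : X ⊗ A ≈ᴹ I
    XA≈I = begin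
      X ⊗ A        ≈⟨ ⊗-cong (inverse-symmetric Aᵀ≈A AX≈I) Aᵀ≈A ⟨
      X ᵀ ⊗ A ᵀ    ≈⟨ ⊗-ᵀ A X ⟨
      (A ⊗ X) ᵀ    ≈⟨ ᵀ-cong AX≈I ⟩
      I ᵀ          ≈⟨ I-ᵀ ⟩
      I            ∎

  -- Penrose's argument: the products of `B` and `C` with `A` agree on either side, and `B ⊗ A ⊗ B`
  -- turns into `C ⊗ A ⊗ C`.
  penrose-unique : ∀ {A B C : Matrix n} → Penrose A B → Penrose A C → B ≈ᴹ C
  penrose-unique {A} {B} {C} PB PC = begin
    B              ≈⟨ B.XAX≈X ⟨
    B ⊗ A ⊗ B      ≈⟨ ⊗-congʳ BA≈CA ⟩
    C ⊗ A ⊗ B      ≈⟨ ⊗-assoc C A B ⟩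
    C ⊗ (A ⊗ B)    ≈⟨ ⊗-congˡ AB≈AC ⟩
    C ⊗ (A ⊗ C)    ≈⟨ ⊗-assoc C A C ⟨
    C ⊗ A ⊗ C      ≈⟨ C.XAX≈X ⟩
    C              ∎
    where
    module B = Penrose PB
    module C = Penrose PC

    -- Inserting `A ⊗ C ⊗ A` for `A` makes `A ⊗ B` a product of two symmetric matrices.
    -- Transposition reverses their order, and then `B` is absorbed.
    AB≈AC : A ⊗ B ≈ᴹ A ⊗ C
    AB≈AC = begin
      A ⊗ B                    ≈⟨ ⊗-congʳ C.AXA≈A ⟨
      A ⊗ C ⊗ A ⊗ B            ≈⟨ ⊗-assoc (A ⊗ C) A B ⟩
      A ⊗ C ⊗ (A ⊗ B)          ≈⟨ ⊗-cong C.AX-sym B.AX-sym ⟨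
      (A ⊗ C) ᵀ ⊗ (A ⊗ B) ᵀ    ≈⟨ ⊗-ᵀ (A ⊗ B) (A ⊗ C) ⟨
      (A ⊗ B ⊗ (A ⊗ C)) ᵀ      ≈⟨ ᵀ-cong (⊗-assoc (A ⊗ B) A C) ⟨
      (A ⊗ B ⊗ A ⊗ C) ᵀ        ≈⟨ ᵀ-cong (⊗-congʳ B.AXA≈A) ⟩
      (A ⊗ C) ᵀ                ≈⟨ C.AX-sym ⟩
      A ⊗ C                    ∎

    BA≈CA : B ⊗ A ≈ᴹ C ⊗ A
    BA≈CA = begin
      B ⊗ A                    ≈⟨ ⊗-congˡ C.AXA≈A ⟨
      B ⊗ (A ⊗ C ⊗ A)          ≈⟨ ⊗-congˡ (⊗-assoc A C A) ⟩
      B ⊗ (A ⊗ (C ⊗ A))        ≈⟨ ⊗-assoc B A (C ⊗ A) ⟨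
      B ⊗ A ⊗ (C ⊗ A)          ≈⟨ ⊗-cong B.XA-sym C.XA-sym ⟨
      (B ⊗ A) ᵀ ⊗ (C ⊗ A) ᵀ    ≈⟨ ⊗-ᵀ (C ⊗ A) (B ⊗ A) ⟨
      (C ⊗ A ⊗ (B ⊗ A)) ᵀ      ≈⟨ ᵀ-cong (⊗-assoc C A (B ⊗ A)) ⟩
      (C ⊗ (A ⊗ (B ⊗ A))) ᵀ    ≈⟨ ᵀ-cong (⊗-congˡ (⊗-assoc A B A)) ⟨
      (C ⊗ (A ⊗ B ⊗ A)) ᵀ      ≈⟨ ᵀ-cong (⊗-congˡ B.AXA≈A) ⟩
      (C ⊗ A) ᵀ                ≈⟨ C.XA-sym ⟩
      C ⊗ A                    ∎

  module _ (L J : Matrix n) (J⊗L≈0 : J ⊗ L ≈ᴹ 0ᴹ) where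
    private
      K A : Matrix n
      K = L ⊗ L ᵀ
      A = J ᵀ ⊗ J ⊕ K

      Kᵀ≈K : K ᵀ ≈ᴹ K
      Kᵀ≈K = ⊗-ᵀ L (L ᵀ)

    gramSum-symmetric : A ᵀ ≈ᴹ A
    gramSum-symmetric = ⊕-cong (⊗-ᵀ (J ᵀ) J) Kᵀ≈K

    gramSum⊗L : A ⊗ L ≈ᴹ K ⊗ L
    gramSum⊗L = begin
      A ⊗ L                    ≈⟨ ⊗-distribʳ-⊕ (J ᵀ ⊗ J) K L ⟩
      J ᵀ ⊗ J ⊗ L ⊕ K ⊗ L      ≈⟨ ⊕-cong (⊗-assoc (J ᵀ) J L) refl ⟩
      J ᵀ ⊗ (J ⊗ L) ⊕ K ⊗ L    ≈⟨ ⊕-cong (trans (⊗-congˡ J⊗L≈0) (⊗-zeroʳ (J ᵀ))) refl ⟩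
      0ᴹ ⊕ K ⊗ L               ≈⟨ ⊕-identityˡ (K ⊗ L) ⟩
      K ⊗ L                    ∎

    -- Here `L ⊗ (L ᵀ ⊗ X)` is `K ⊗ X`. The first three equations use that `K` and `X` commute,
    -- together with `XKL≈L`, its transpose, and symmetry respectively; the last comes from the
    -- symmetry of `X`.
    penrose-gramSum : ((X , _) : Invertible A) → Penrose L (L ᵀ ⊗ X)
    penrose-gramSum (X , XA≈I , AX≈I) = record
      { AXA≈A  = begin
          L ⊗ (L ᵀ ⊗ X) ⊗ L    ≈⟨ ⊗-congʳ (trans LM≈KX (sym XK≈KX)) ⟩
          X ⊗ K ⊗ L            ≈⟨ XKL≈L ⟩
          L                    ∎
      ; XAX≈X  = begin
          L ᵀ ⊗ X ⊗ L ⊗ (L ᵀ ⊗ X)      ≈⟨ ⊗-assoc (L ᵀ ⊗ X) L (L ᵀ ⊗ X) ⟩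
          L ᵀ ⊗ X ⊗ (L ⊗ (L ᵀ ⊗ X))    ≈⟨ ⊗-congˡ LM≈KX ⟩
          L ᵀ ⊗ X ⊗ (K ⊗ X)            ≈⟨ ⊗-assoc (L ᵀ ⊗ X) K X ⟨
          L ᵀ ⊗ X ⊗ K ⊗ X              ≈⟨ ⊗-congʳ (trans (⊗-assoc (L ᵀ) X K)
                                            (trans (⊗-congˡ XK≈KX) LᵀKX≈Lᵀ)) ⟩
          L ᵀ ⊗ X                      ∎
      ; AX-sym = begin
          (L ⊗ (L ᵀ ⊗ X)) ᵀ    ≈⟨ ᵀ-cong LM≈KX ⟩
          (K ⊗ X) ᵀ            ≈⟨ ⊗-ᵀ K X ⟩
          X ᵀ ⊗ K ᵀ            ≈⟨ ⊗-cong Xᵀ≈X Kᵀ≈K ⟩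
          X ⊗ K                ≈⟨ trans XK≈KX (sym LM≈KX) ⟩
          L ⊗ (L ᵀ ⊗ X)        ∎
      ; XA-sym = begin
          (L ᵀ ⊗ X ⊗ L) ᵀ      ≈⟨ ⊗-ᵀ (L ᵀ ⊗ X) L ⟩
          L ᵀ ⊗ (L ᵀ ⊗ X) ᵀ    ≈⟨ ⊗-congˡ (⊗-ᵀ (L ᵀ) X) ⟩
          L ᵀ ⊗ (X ᵀ ⊗ L)      ≈⟨ ⊗-congˡ (⊗-congʳ Xᵀ≈X) ⟩
          L ᵀ ⊗ (X ⊗ L)        ≈⟨ ⊗-assoc (L ᵀ) X L ⟨
          L ᵀ ⊗ X ⊗ L          ∎
      }
      where
      Xᵀ≈X : X ᵀ ≈ᴹ X
      Xᵀ≈X = inverse-symmetric gramSum-symmetric AX≈I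

      LM≈KX : L ⊗ (L ᵀ ⊗ X) ≈ᴹ K ⊗ X
      LM≈KX = sym (⊗-assoc L (L ᵀ) X)

      XKL≈L : X ⊗ K ⊗ L ≈ᴹ L
      XKL≈L = begin
        X ⊗ K ⊗ L      ≈⟨ ⊗-assoc X K L ⟩
        X ⊗ (K ⊗ L)    ≈⟨ ⊗-congˡ gramSum⊗L ⟨
        X ⊗ (A ⊗ L)    ≈⟨ ⊗-assoc X A L ⟨
        X ⊗ A ⊗ L      ≈⟨ ⊗-congʳ XA≈I ⟩
        I ⊗ L          ≈⟨ ⊗-identityˡ L ⟩
        L              ∎

      -- This is the transpose of `XKL≈L`.
      LᵀKX≈Lᵀ : L ᵀ ⊗ (K ⊗ X) ≈ᴹ L ᵀ
      LᵀKX≈Lᵀ = begin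
        L ᵀ ⊗ (K ⊗ X)        ≈⟨ ⊗-congˡ (⊗-cong Kᵀ≈K Xᵀ≈X) ⟨
        L ᵀ ⊗ (K ᵀ ⊗ X ᵀ)    ≈⟨ ⊗-congˡ (⊗-ᵀ X K) ⟨
        L ᵀ ⊗ (X ⊗ K) ᵀ      ≈⟨ ⊗-ᵀ (X ⊗ K) L ⟨
        (X ⊗ K ⊗ L) ᵀ        ≈⟨ ᵀ-cong XKL≈L ⟩
        L ᵀ                  ∎

      -- By `gramSum⊗L` the product `A ⊗ K` is `K ⊗ K`, which is symmetric, and symmetric matrices
      -- with a symmetric product commute.
      AK≈KA : A ⊗ K ≈ᴹ K ⊗ A
      AK≈KA = trans AK≈KK (begin
        K ⊗ K        ≈⟨ ⊗-cong Kᵀ≈K Kᵀ≈K ⟨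
        K ᵀ ⊗ K ᵀ    ≈⟨ ⊗-ᵀ K K ⟨
        (K ⊗ K) ᵀ    ≈⟨ ᵀ-cong AK≈KK ⟨
        (A ⊗ K) ᵀ    ≈⟨ ⊗-ᵀ A K ⟩
        K ᵀ ⊗ A ᵀ    ≈⟨ ⊗-cong Kᵀ≈K gramSum-symmetric ⟩
        K ⊗ A        ∎)
        where
        AK≈KK : A ⊗ K ≈ᴹ K ⊗ K
        AK≈KK = begin
          A ⊗ K            ≈⟨ ⊗-assoc A L (L ᵀ) ⟨
          A ⊗ L ⊗ L ᵀ      ≈⟨ ⊗-congʳ gramSum⊗L ⟩
          K ⊗ L ⊗ L ᵀ      ≈⟨ ⊗-assoc K L (L ᵀ) ⟩
          K ⊗ K            ∎

      XK≈KX : X ⊗ K ≈ᴹ K ⊗ X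
      XK≈KX = begin
        X ⊗ K                ≈⟨ ⊗-identityʳ (X ⊗ K) ⟨
        X ⊗ K ⊗ I            ≈⟨ ⊗-congˡ AX≈I ⟨
        X ⊗ K ⊗ (A ⊗ X)      ≈⟨ ⊗-assoc (X ⊗ K) A X ⟨
        X ⊗ K ⊗ A ⊗ X        ≈⟨ ⊗-congʳ (trans (⊗-assoc X K A) (⊗-congˡ (sym AK≈KA))) ⟩
        X ⊗ (A ⊗ K) ⊗ X      ≈⟨ ⊗-congʳ (⊗-assoc X A K) ⟨
        X ⊗ A ⊗ K ⊗ X        ≈⟨ ⊗-congʳ (trans (⊗-congʳ XA≈I) (⊗-identityˡ K)) ⟩
        K ⊗ X                ∎

    -- The cross terms `L ⊗ J` and its transpose vanish.
    gramSum≈ZZᵀ : L ⊗ J ≈ᴹ 0ᴹ → (L ⊕ J ᵀ) ⊗ (L ⊕ J ᵀ) ᵀ ≈ᴹ A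
    gramSum≈ZZᵀ L⊗J≈0 = begin
      (L ⊕ J ᵀ) ⊗ (L ᵀ ⊕ J)
        ≈⟨ ⊗-distribʳ-⊕ L (J ᵀ) (L ᵀ ⊕ J) ⟩
      L ⊗ (L ᵀ ⊕ J) ⊕ J ᵀ ⊗ (L ᵀ ⊕ J)
        ≈⟨ ⊕-cong (⊗-distribˡ-⊕ L (L ᵀ) J) (⊗-distribˡ-⊕ (J ᵀ) (L ᵀ) J) ⟩
      K ⊕ L ⊗ J ⊕ (J ᵀ ⊗ L ᵀ ⊕ J ᵀ ⊗ J)
        ≈⟨ ⊕-cong (trans (⊕-cong refl L⊗J≈0) (⊕-identityʳ K))
             (trans (⊕-cong (trans (sym (⊗-ᵀ L J)) (ᵀ-cong L⊗J≈0)) refl) (⊕-identityˡ (J ᵀ ⊗ J))) ⟩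
      K ⊕ J ᵀ ⊗ J
        ≈⟨ (λ i j → +-comm _ _) ⟩
      A ∎

-- The Moore-Penrose inverse of the Kirchhoff matrix

open import Data.Nat.Base using (_<_)

theorem12 : ∀ {c ℓ₁ ℓ₂} (ℝ : RealField c ℓ₁ ℓ₂) → let open OverReals ℝ in
    (n : ℕ) → 1 < n → (Γ : WeightedDigraph n) →
    let L = kirchhoff Γ
        J = J̄ Γ
        Z = L ⊕ J ᵀ
    in
    Σ (Invertible (Z ⊗ Z ᵀ)) λ (P , _) →
    Σ (Invertible (J ᵀ ⊗ J ⊕ L ⊗ L ᵀ)) λ (Q , _) →
      (L ᵀ ⊗ P ≈ᴹ L ᵀ ⊗ Q) × IsMoorePenroseInverse L (L ᵀ ⊗ P)
theorem12 ℝ n _ Γ =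
  -- The same matrix `X` inverts both `Z ⊗ Z ᵀ` and `A`, so the two formulas agree by reflexivity.
  (X , trans (⊗-congˡ ZZᵀ≈A) XA≈I , trans (⊗-congʳ ZZᵀ≈A) AX≈I) ,
  A⁻¹ , refl , penrose , λ Y penroseY → penrose-unique penroseY penrose
  where
  open OverReals ℝ
  open MatrixAlgebra ℝ
  open MaximumForests ℝ Γ
  open MoorePenrose ℝ {n}
  open Setoid (ᴹ-setoid {n}) using (refl; trans)
  L = kirchhoff Γ
  J = J̄ Γ
  A = J ᵀ ⊗ J ⊕ L ⊗ L ᵀ

  ZZᵀ≈A : (L ⊕ J ᵀ) ⊗ (L ⊕ J ᵀ) ᵀ ≈ᴹ A
  ZZᵀ≈A = gramSum≈ZZᵀ L J J̄⊗L L⊗J̄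

  A⁻¹ : Invertible A
  A⁻¹ = posDef⇒invertible (gramSum-symmetric L J J̄⊗L) (gramSum-posDef (proj₂ I-J̄∈imageOfL))

  X = proj₁ A⁻¹
  XA≈I = proj₁ (proj₂ A⁻¹)
  AX≈I = proj₂ (proj₂ A⁻¹)

  penrose : Penrose L (L ᵀ ⊗ X)
  penrose = penrose-gramSum L J J̄⊗L A⁻¹
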